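{- Let $v\ge 2$ be an integer and $p$ a prime with $p\equiv 1\pmod v$ and $p-1>v$. Let $T$ be the number of permutations $\pi$ of $\{1,\dots,p-1\}$ such that the sequence $\pi_v=(\pi(1)\,\%\,v,\dots,\pi(p-1)\,\%\,v)$ has least period $p-1$. Let $k=(p-1)/v$, let $Q$ be the set of prime divisors of $k$ and $q'=\min Q$. Then $$(p-1)!\left(1-\sum_{q\in Q}\frac{\left(\frac{p-1}{q}\right)!\,(k!)^v}{(p-1)!\,\left(\left(\frac{k}{q}\right)!\right)^v}\right)\ \le\ T\ \le\ (p-1)!\left(1-\frac{\left(\frac{p-1}{q'}\right)!\,(k!)^v}{(p-1)!\,\left(\left(\frac{k}{q'}\right)!\right)^v}\right).$$ Moreover, for fixed $v$: for every $\varepsilon>0$ there exists $n_\varepsilon$ such that for all primes $p\ge n_\varepsilon$ with $p\equiv1\pmod v$, $(p-1)!(1-\varepsilon)\le T\le (p-1)!$.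
   Context: $x\,\%\,v$ is the least nonnegative remainder modulo $v$. A sequence of length $N$ is regarded cyclically; its least period is the smallest $\rho>0$ with $s(i+\rho)=s(i)$ for all indices $i$ taken modulo $N$. -}

module Defs where

open import Data.Fin.Base using (Fin; toℕ; finToFun)
open import Data.Fin.Properties using (all?; any?; nonZeroIndex) renaming (_≟_ to _≟ᶠ_)
open import Data.Integer.Base using (+_)
open import Data.List.Base using (allFin; filter; foldr; length; map; upTo)
open import Data.Nat.Base
open import Data.Nat.Divisibility using (_∣_; _∣?_)
open import Data.Nat.DivMod using (_mod_)
open import Data.Nat.Primality using (Prime; prime?)
open import Data.Nat.Properties using (_≟_; _<?_; allUpTo?; _!≢0; m*n≢0; m^n≢0)
open import Data.Product.Base using (_×_; _,_; ∃; map₂)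
open import Data.Rational.Base as ℚ using (ℚ; 0ℚ)
open import Function.Definitions using (Injective; Surjective; Bijective)
open import Relation.Binary.PropositionalEquality using (_≡_; refl)
open import Relation.Nullary.Decidable using (Dec; map′; _×-dec_; _→-dec_; ¬?)
open import Relation.Nullary.Negation using (¬_)
open import Relation.Unary using (Decidable)

-- Positions are 0-based, so a sequence of length n is a function on Fin n
-- and position i + ρ is reduced modulo n.

IsPeriod : ∀ {n} → (Fin n → ℕ) → ℕ → Set
IsPeriod {n} s ρ =
  0 < ρ × (∀ i → s (_mod_ (toℕ i + ρ) n {{nonZeroIndex i}}) ≡ s i)

IsLeastPeriod : ∀ {n} → (Fin n → ℕ) → ℕ → Set
IsLeastPeriod s ρ = IsPeriod s ρ × (∀ {σ} → σ < ρ → ¬ IsPeriod s σ)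

isPeriod? : ∀ {n} (s : Fin n → ℕ) → Decidable (IsPeriod s)
isPeriod? s ρ = 0 <? ρ ×-dec all? (λ i → _ ≟ s i)

isLeastPeriod? : ∀ {n} (s : Fin n → ℕ) → Decidable (IsLeastPeriod s)
isLeastPeriod? s ρ = isPeriod? s ρ ×-dec allUpTo? (λ σ → ¬? (isPeriod? s σ)) ρ

-- A map f : Fin n → Fin n stands for the map i + 1 ↦ f i + 1 of {1, …, n}.

residues : ∀ v .{{_ : NonZero v}} {n} → (Fin n → Fin n) → Fin n → ℕ
residues v f i = suc (toℕ (f i)) % v

IsPermutation : ∀ {n} → (Fin n → Fin n) → Set
IsPermutation = Bijective _≡_ _≡_

isPermutation? : ∀ {n} → Decidable (IsPermutation {n})
isPermutation? f = injective? ×-dec surjective?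
  where
  injective? : Dec (Injective _≡_ _≡_ f)
  injective? = map′ (λ h {x} {y} → h x y) (λ h x y → h)
    (all? λ x → all? λ y → (f x ≟ᶠ f y) →-dec (x ≟ᶠ y))

  surjective? : Dec (Surjective _≡_ _≡_ f)
  surjective? = map′
    (λ h y → map₂ (λ { eq refl → eq }) (h y))
    (λ h y → map₂ (λ k → k refl) (h y))
    (all? λ y → any? λ x → f x ≟ᶠ y)

FullPeriodPermutation : ∀ v .{{_ : NonZero v}} {n} → (Fin n → Fin n) → Set
FullPeriodPermutation v {n} f = IsPermutation f × IsLeastPeriod (residues v f) n

fullPeriodPermutation? : ∀ v .{{_ : NonZero v}} {n} →
                         Decidable (FullPeriodPermutation v {n})
fullPeriodPermutation? v {n} f =
  isPermutation? f ×-dec isLeastPeriod? (residues v f) n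

-- Up to pointwise equality, finToFun enumerates each map Fin n → Fin n exactly
-- once as its argument ranges over Fin (n ^ n).

fullPeriodCount : ∀ v .{{_ : NonZero v}} → ℕ → ℕ
fullPeriodCount v n =
  length
    (filter (λ c → fullPeriodPermutation? v (finToFun {n} {n} c)) (allFin (n ^ n)))

PrimeDivisor : ℕ → ℕ → Set
PrimeDivisor k q = Prime q × q ∣ k

primeDivisor? : ∀ k → Decidable (PrimeDivisor k)
primeDivisor? k q = prime? q ×-dec (q ∣? k)

IsLeastPrimeDivisor : ℕ → ℕ → Set
IsLeastPrimeDivisor k q = PrimeDivisor k q × (∀ {r} → PrimeDivisor k r → q ≤ r)

-- For k > 0, the prime divisors of k all lie in {1, …, k}; they are written
-- suc i with i < k so that the summand may divide by them.

∑primeDivisors : ℕ → ((q : ℕ) .{{_ : NonZero q}} → ℚ) → ℚ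
∑primeDivisors k f =
  foldr ℚ._+_ 0ℚ
    (map (λ i → f (suc i)) (filter (λ i → primeDivisor? k (suc i)) (upTo k)))

fromℕ : ℕ → ℚ
fromℕ m = + m ℚ./ 1

-- (n/q)! (k!)^v / (n! ((k/q)!)^v) with k = n / v.

ratio : ∀ v .{{_ : NonZero v}} → ℕ → (q : ℕ) .{{_ : NonZero q}} → ℚ
ratio v n q =
  ℚ._/_ (+ ((n / q) ! * (k !) ^ v)) (n ! * ((k / q) !) ^ v) {{denominator≢0}}
  where
  k : ℕ
  k = n / v

  denominator≢0 : NonZero (n ! * ((k / q) !) ^ v)
  denominator≢0 =
    m*n≢0 (n !) _ {{n !≢0}} {{m^n≢0 ((k / q) !) v {{(k / q) !≢0}}}}

module Submission where

open import Defs
open import Algebra.Properties.Semiring.Sum as Sum using ()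
open import Data.Bool.Base using (true; false; if_then_else_)
open import Data.Fin.Base using (Fin; zero; suc; toℕ; inject₁; punchOut; _↑ˡ_; _↑ʳ_; combine; finToFun; funToFin)
  renaming (fromℕ to fromℕᶠ)
open import Data.Fin.Permutation using (permutation)
open import Data.Fin.Properties as Fin using ()
open import Data.Integer.Base as ℤ using (-[1+_])
import Data.Integer.Properties as ℤ
open import Data.List.Base using (List; []; _∷_; filter; foldr; length; map; tabulate; upTo)
open import Data.List.Membership.Propositional using (_∈_)
open import Data.List.Membership.Propositional.Properties using (∈-filter⁺; ∈-upTo⁺)
open import Data.List.Properties using (length-filter; length-upTo)
open import Data.List.Relation.Unary.All using (All; []; _∷_)
open import Data.List.Relation.Unary.All.Properties using (all-filter)
open import Data.List.Relation.Unary.Any using (here; there)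
open import Data.Maybe.Base using (Maybe; just; nothing)
open import Data.Maybe.Properties using (≡-dec; just-injective)
open import Data.Nat.Base
open import Data.Nat.Divisibility
open import Data.Nat.DivMod
open import Data.Nat.GCD using (module GCD; module Bézout)
open import Data.Nat.ListAction using (product) renaming (sum to sumᴸ)
open import Data.Nat.Primality using (Prime; prime⇒nonTrivial)
open import Data.Nat.Primality.Factorisation using (PrimeFactorisation; factorise)
open import Data.Nat.Properties
open import Data.Nat.Solver using (module +-*-Solver)
open import Data.Product.Base using (_×_; _,_; proj₁; proj₂; ∃)
open import Data.Rational.Base as ℚ using (ℚ; 0ℚ; 1ℚ; mkℚ; toℚᵘ; ↧ₙ_)
import Data.Rational.Properties as ℚ
open import Data.Rational.Unnormalised.Base as ℚᵘ using (mkℚᵘ)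
import Data.Rational.Unnormalised.Properties as ℚᵘ
open import Data.Vec.Functional using (updateAt) renaming (_∷_ to _∷ᶠ_)
open import Data.Vec.Functional.Properties using (updateAt-updates; updateAt-minimal)
open import Function.Base using (_∘_; const; id; it)
open import Function.Definitions using (Injective; Surjective)
open import Relation.Binary.PropositionalEquality
open import Relation.Nullary.Decidable using (Dec; yes; no; does; map′; _×-dec_; _→-dec_)
open import Relation.Nullary.Negation using (¬_; contradiction)
open import Relation.Unary using (Decidable)

open Sum +-*-semiring
  using (sum; sum-syntax; sum-cong-≗; sum-replicate-zero; sum-init-last; sum-permute;
         ∑-distrib-+; ∑-comm; *-distribˡ-sum; *-distribʳ-sum)

-- Colour a permutation π of n = k v points by residues modulo v. Every colour
-- class has k elements, so a word of length n is the colouring of (k!)^v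
-- permutations if it is balanced (each letter occurs k times) and of none
-- otherwise. A word of period n/q with q ∣ k is balanced iff its first n/q
-- letters are, and the number B of balanced words of length n/q satisfies
-- B ((k/q)!)^v = (n/q)!, by the same count applied to permutations of n/q points.
-- Hence A_q = (n/q)! (k!)^v / ((k/q)!)^v permutations have a colouring of period
-- n/q. If the least period g of the colouring is a proper divisor of n, then the
-- colouring has period n/q for some prime q ∣ n/g, and balance forces q ∣ k; so
-- n! − Σ_q A_q ≤ T ≤ n! − A_q′. Finally (k v)!/(k!)^v at least doubles when k
-- increases by one, whence A_q 2^(k − k/q) ≤ n!, and Σ_q A_q = o(n!).

private
  variable
    X P Q R : Set
    m n v : ℕ

-- Indicators of decidable propositions and finite sums.

𝟙 : Dec P → ℕ
𝟙 P? = if does P? then 1 else 0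

𝟙-yes : (P? : Dec P) → P → 𝟙 P? ≡ 1
𝟙-yes (yes _) _ = refl
𝟙-yes (no ¬p) p = contradiction p ¬p

𝟙-no : (P? : Dec P) → ¬ P → 𝟙 P? ≡ 0
𝟙-no (yes p) ¬p = contradiction p ¬p
𝟙-no (no _)  _  = refl

𝟙-mono : (P? : Dec P) (Q? : Dec Q) → (P → Q) → 𝟙 P? ≤ 𝟙 Q?
𝟙-mono (no _)  _  _   = z≤n
𝟙-mono (yes p) Q? p⇒q = ≤-reflexive (sym (𝟙-yes Q? (p⇒q p)))

𝟙-cong : (P? : Dec P) (Q? : Dec Q) → (P → Q) → (Q → P) → 𝟙 P? ≡ 𝟙 Q?
𝟙-cong P? Q? p⇒q q⇒p = ≤-antisym (𝟙-mono P? Q? p⇒q) (𝟙-mono Q? P? q⇒p)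

𝟙-× : (P? : Dec P) (Q? : Dec Q) → 𝟙 (P? ×-dec Q?) ≡ 𝟙 P? * 𝟙 Q?
𝟙-× (yes _) Q? = sym (*-identityˡ (𝟙 Q?))
𝟙-× (no _)  Q? = refl

𝟙-*-cong : ∀ (P? : Dec P) {a b} → (P → a ≡ b) → 𝟙 P? * a ≡ 𝟙 P? * b
𝟙-*-cong (yes p) a≡b = cong (1 *_) (a≡b p)
𝟙-*-cong (no _)  _   = refl

≡𝟙-* : ∀ (P? : Dec P) {a b} → (P → a ≡ b) → (¬ P → a ≡ 0) → a ≡ 𝟙 P? * b
≡𝟙-* (yes p) {b = b} a≡b _ = trans (a≡b p) (sym (*-identityˡ b))
≡𝟙-* (no ¬p) _ a≡0 = a≡0 ¬p

∑-zero : (f : Fin n → ℕ) → (∀ i → f i ≡ 0) → sum f ≡ 0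
∑-zero {n} f f≗0 = trans (sum-cong-≗ f≗0) (sum-replicate-zero n)

∑-mono : {f g : Fin n → ℕ} → (∀ i → f i ≤ g i) → sum f ≤ sum g
∑-mono {zero}  _   = z≤n
∑-mono {suc n} f≤g = +-mono-≤ (f≤g zero) (∑-mono (f≤g ∘ suc))

∑-δ : (i : Fin n) (f : Fin n → ℕ) → ∑[ j < n ] (𝟙 (i Fin.≟ j) * f j) ≡ f i
∑-δ {suc n} zero f =
  trans (cong₂ _+_ (+-identityʳ (f zero)) (∑-zero {n} (λ _ → 0) λ _ → refl)) (+-identityʳ (f zero))
∑-δ (suc i) f = ∑-δ i (f ∘ suc)

∑-+ : ∀ m {n} (f : Fin (m + n) → ℕ) →
      sum f ≡ ∑[ i < m ] f (i ↑ˡ n) + ∑[ j < n ] f (m ↑ʳ j)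
∑-+ zero    f = refl
∑-+ (suc m) f = trans (cong (f zero +_) (∑-+ m (f ∘ suc))) (sym (+-assoc (f zero) _ _))

∑-* : ∀ m {n} (f : Fin (m * n) → ℕ) →
      sum f ≡ ∑[ i < m ] ∑[ j < n ] f (combine i j)
∑-* zero        f = refl
∑-* (suc m) {n} f = trans (∑-+ n f) (cong (∑[ j < n ] f (j ↑ˡ (m * n)) +_) (∑-* m (f ∘ (n ↑ʳ_))))

-- Sums over all maps between two finite sets.

∑ᶠ : ((Fin n → Fin m) → ℕ) → ℕ
∑ᶠ {n} {m} g = ∑[ c < m ^ n ] g (finToFun c)

-- Decoding the code of a map returns it only up to pointwise equality, so summands have to respect
-- that equality.
Extensional : ((Fin n → Fin m) → ℕ) → Set
Extensional g = ∀ {f h} → f ≗ h → g f ≡ g h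

_≗?_ : (f h : Fin n → Fin m) → Dec (f ≗ h)
f ≗? h = Fin.all? λ i → f i Fin.≟ h i

funToFin-cong : {f h : Fin n → Fin m} → f ≗ h → funToFin f ≡ funToFin h
funToFin-cong {zero}  _   = refl
funToFin-cong {suc n} f≗h = cong₂ combine (f≗h zero) (funToFin-cong (f≗h ∘ suc))

∑ᶠ-δ : (f : Fin n → Fin m) {g : (Fin n → Fin m) → ℕ} → Extensional g →
       ∑ᶠ (λ h → 𝟙 (f ≗? h) * g h) ≡ g f
∑ᶠ-δ {n} {m} f {g} ext = begin
  ∑[ c < m ^ n ] (𝟙 (f ≗? finToFun c) * g (finToFun c))
    ≡⟨ sum-cong-≗ (λ c → cong (_* g (finToFun c))
         (𝟙-cong (f ≗? finToFun c) (funToFin f Fin.≟ c)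
            (λ f≗c → trans (funToFin-cong f≗c) (Fin.funToFin-finToFin {n} c))
            (λ { refl i → sym (Fin.finToFun-funToFin f i) }))) ⟩
  ∑[ c < m ^ n ] (𝟙 (funToFin f Fin.≟ c) * g (finToFun c))
    ≡⟨ ∑-δ (funToFin f) (g ∘ finToFun) ⟩
  g (finToFun (funToFin f))
    ≡⟨ ext (Fin.finToFun-funToFin f) ⟩
  g f ∎
  where open ≡-Reasoning

∑ᶠ-suc : {g : (Fin (suc n) → Fin m) → ℕ} → Extensional g →
         ∑ᶠ g ≡ ∑[ x < m ] ∑ᶠ (λ f → g (x ∷ᶠ f))
∑ᶠ-suc {n} {m} {g} ext =
  trans (∑-* m (g ∘ finToFun)) (sum-cong-≗ λ x → sum-cong-≗ λ c → ext (finToFun-combine x c))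
  where
  finToFun-combine : ∀ x c → finToFun {m} {suc n} (combine x c) ≗ (x ∷ᶠ finToFun c)
  finToFun-combine x c zero    = cong proj₁ (Fin.remQuot-combine x c)
  finToFun-combine x c (suc i) = cong (λ rq → finToFun (proj₂ rq) i) (Fin.remQuot-combine {m} x c)

-- Injections that realise a prescribed word of colours.

count : (Fin n → Fin v) → Fin v → ℕ
count {n} s c = ∑[ i < n ] 𝟙 (s i Fin.≟ c)

_≟ᵐ_ : (x y : Maybe (Fin v)) → Dec (x ≡ y)
_≟ᵐ_ = ≡-dec Fin._≟_

countᵐ : (Fin n → Maybe (Fin v)) → Fin v → ℕ
countᵐ {n} col c = ∑[ i < n ] 𝟙 (col i ≟ᵐ just c)

erase : Fin m → (Fin m → Maybe (Fin v)) → (Fin m → Maybe (Fin v))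
erase x col = updateAt col x (const nothing)

-- Only the summand at `x` changes: it drops from the indicator of `a ≡ c` to 0.
countᵐ-erase : ∀ (col : Fin m → Maybe (Fin v)) x {a} → col x ≡ just a → ∀ c →
               countᵐ col c ≡ 𝟙 (a Fin.≟ c) + countᵐ (erase x col) c
countᵐ-erase {m} col x {a} colx≡a c = begin
  countᵐ col c
    ≡⟨ sum-cong-≗ split ⟩
  ∑[ y < m ] (𝟙 (x Fin.≟ y) * 𝟙 (a Fin.≟ c) + 𝟙 (erase x col y ≟ᵐ just c))
    ≡⟨ ∑-distrib-+ (λ y → 𝟙 (x Fin.≟ y) * 𝟙 (a Fin.≟ c)) _ ⟩
  ∑[ y < m ] (𝟙 (x Fin.≟ y) * 𝟙 (a Fin.≟ c)) + countᵐ (erase x col) c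
    ≡⟨ cong (_+ countᵐ (erase x col) c) (∑-δ x _) ⟩
  𝟙 (a Fin.≟ c) + countᵐ (erase x col) c ∎
  where
  open ≡-Reasoning
  split : ∀ y → 𝟙 (col y ≟ᵐ just c) ≡ 𝟙 (x Fin.≟ y) * 𝟙 (a Fin.≟ c) + 𝟙 (erase x col y ≟ᵐ just c)
  split y with x Fin.≟ y
  ... | no x≢y rewrite updateAt-minimal y x {const nothing} col (x≢y ∘ sym) = refl
  ... | yes refl rewrite updateAt-updates x {const nothing} col | colx≡a
                       | +-identityʳ (𝟙 (a Fin.≟ c)) | +-identityʳ (𝟙 (a Fin.≟ c)) = refl

∏ : (Fin n → ℕ) → ℕ
∏ {zero}  f = 1
∏ {suc n} f = f zero * ∏ (f ∘ suc)

∏-cong : {f g : Fin n → ℕ} → f ≗ g → ∏ f ≡ ∏ g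
∏-cong {zero}  _   = refl
∏-cong {suc n} f≗g = cong₂ _*_ (f≗g zero) (∏-cong (f≗g ∘ suc))

∏-const : ∀ n a → ∏ {n} (const a) ≡ a ^ n
∏-const zero    a = refl
∏-const (suc n) a = cong (a *_) (∏-const n a)

-- Only the factor at `a` changes. In the recursion of `∑-matches`, the extra factor `suc (f a)` is
-- the number of choices for the first point.
∏-!-suc : (a : Fin v) (f : Fin v → ℕ) →
          ∏ (λ c → (𝟙 (a Fin.≟ c) + f c) !) ≡ suc (f a) * ∏ (λ c → f c !)
∏-!-suc zero    f = *-assoc (suc (f zero)) (f zero !) _
∏-!-suc (suc a) f = begin
  f zero ! * ∏ (λ c → (𝟙 (a Fin.≟ c) + f (suc c)) !)  ≡⟨ cong (f zero ! *_) (∏-!-suc a (f ∘ suc)) ⟩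
  f zero ! * (suc (f (suc a)) * r)                    ≡⟨ *-assoc (f zero !) _ r ⟨
  f zero ! * suc (f (suc a)) * r                      ≡⟨ cong (_* r) (*-comm (f zero !) _) ⟩
  suc (f (suc a)) * f zero ! * r                      ≡⟨ *-assoc (suc (f (suc a))) (f zero !) r ⟩
  suc (f (suc a)) * (f zero ! * r)                    ∎
  where
  open ≡-Reasoning
  r = ∏ (λ c → f (suc c) !)

Matches : (Fin m → Maybe (Fin v)) → (Fin n → Fin v) → (Fin n → Fin m) → Set
Matches col s f = Injective _≡_ _≡_ f × (∀ i → col (f i) ≡ just (s i))

injective? : (f : Fin n → Fin m) → Dec (Injective _≡_ _≡_ f)
injective? f = map′ (λ h {x} {y} → h x y) (λ h x y → h)
  (Fin.all? λ x → Fin.all? λ y → (f x Fin.≟ f y) →-dec (x Fin.≟ y))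

injective-cong : {f h : Fin n → Fin m} → f ≗ h → Injective _≡_ _≡_ f → Injective _≡_ _≡_ h
injective-cong f≗h inj {x} {y} eq = inj (trans (f≗h x) (trans eq (sym (f≗h y))))

matches? : (col : Fin m → Maybe (Fin v)) (s : Fin n → Fin v) (f : Fin n → Fin m) → Dec (Matches col s f)
matches? col s f = injective? f ×-dec Fin.all? λ i → col (f i) ≟ᵐ just (s i)

matches-extensional : (col : Fin m → Maybe (Fin v)) (s : Fin n → Fin v) →
                      Extensional (λ f → 𝟙 (matches? col s f))
matches-extensional col s {f} {h} f≗h =
  𝟙-cong (matches? col s f) (matches? col s h) (transport f≗h) (transport (sym ∘ f≗h))
  where
  transport : ∀ {f h} → f ≗ h → Matches col s f → Matches col s h
  transport f≗h (inj , eq) = injective-cong f≗h inj , λ i → trans (cong col (sym (f≗h i))) (eq i)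

-- This is how erasing encodes injectivity: the letters of a word all demand a colour, so a match of
-- the tail can never return to `x`.
erase-just : ∀ {col : Fin m → Maybe (Fin v)} x y {a} → erase x col y ≡ just a → x ≢ y × col y ≡ just a
erase-just {col = col} x y eq with x Fin.≟ y
... | yes refl = contradiction (trans (sym (updateAt-updates x col)) eq) λ ()
... | no  x≢y  = x≢y , trans (sym (updateAt-minimal y x col (x≢y ∘ sym))) eq

matches-∷⁻ : ∀ {col : Fin m → Maybe (Fin v)} {s : Fin (suc n) → Fin v} {x f} →
             Matches col s (x ∷ᶠ f) → col x ≡ just (s zero) × Matches (erase x col) (s ∘ suc) f
matches-∷⁻ {col = col} {x = x} {f} (inj , eq) =
  eq zero ,
  (λ e → Fin.suc-injective (inj e)) ,
  λ i → trans (updateAt-minimal (f i) x col λ e → Fin.0≢1+n (sym (inj {suc i} {zero} e))) (eq (suc i))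

matches-∷⁺ : ∀ {col : Fin m → Maybe (Fin v)} {s : Fin (suc n) → Fin v} {x f} →
             col x ≡ just (s zero) × Matches (erase x col) (s ∘ suc) f → Matches col s (x ∷ᶠ f)
matches-∷⁺ {col = col} {s} {x} {f} (colx , inj , eq) = inj′ , eq′
  where
  fresh : ∀ i → x ≢ f i × col (f i) ≡ just (s (suc i))
  fresh i = erase-just x (f i) (eq i)

  inj′ : Injective _≡_ _≡_ (x ∷ᶠ f)
  inj′ {zero}  {zero}  _ = refl
  inj′ {zero}  {suc j} e = contradiction e (proj₁ (fresh j))
  inj′ {suc i} {zero}  e = contradiction (sym e) (proj₁ (fresh i))
  inj′ {suc i} {suc j} e = cong suc (inj e)

  eq′ : ∀ i → col ((x ∷ᶠ f) i) ≡ just (s i)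
  eq′ zero    = colx
  eq′ (suc i) = proj₂ (fresh i)

-- The colours already used up are recorded by recolouring the chosen points
-- with nothing.
∑-matches : ∀ {n} (col : Fin m → Maybe (Fin v)) (s : Fin n → Fin v) →
            (∀ c → countᵐ col c ≡ count s c) →
            ∑ᶠ (λ f → 𝟙 (matches? col s f)) ≡ ∏ (λ c → count s c !)
∑-matches {m} {v} {zero} col s _ =
  trans (trans (+-identityʳ (𝟙 (matches? {m} {v} {0} col s (finToFun zero))))
               (𝟙-yes (matches? {m} {v} {0} col s (finToFun zero)) ((λ { {()} }) , λ ())))
        (sym (trans (∏-const v 1) (^-zeroˡ v)))
∑-matches {m} {v} {suc n} col s counts = begin
  ∑ᶠ (λ f → 𝟙 (matches? col s f))
    ≡⟨ ∑ᶠ-suc (matches-extensional col s) ⟩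
  ∑[ x < m ] ∑ᶠ (λ f → 𝟙 (matches? col s (x ∷ᶠ f)))
    ≡⟨ sum-cong-≗ (λ x → sum-cong-≗ λ c → let f = finToFun c in trans
         (𝟙-cong (matches? col s (x ∷ᶠ f)) ((col x ≟ᵐ just (s zero)) ×-dec matches? (erase x col) s′ f)
                 matches-∷⁻ matches-∷⁺)
         (𝟙-× (col x ≟ᵐ just (s zero)) (matches? (erase x col) s′ f))) ⟩
  ∑[ x < m ] ∑ᶠ (λ f → 𝟙 (col x ≟ᵐ just (s zero)) * 𝟙 (matches? (erase x col) s′ f))
    ≡⟨ sum-cong-≗ (λ x → *-distribˡ-sum (𝟙 (col x ≟ᵐ just (s zero)))
         (λ c → 𝟙 (matches? (erase x col) s′ (finToFun c)))) ⟨
  ∑[ x < m ] (𝟙 (col x ≟ᵐ just (s zero)) * ∑ᶠ (λ f → 𝟙 (matches? (erase x col) s′ f)))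
    -- The induction hypothesis is required only where `x` has the colour `s zero`; there, erasing
    -- `x` and dropping the first letter lower both counts by the same indicator.
    ≡⟨ sum-cong-≗ (λ x → 𝟙-*-cong (col x ≟ᵐ just (s zero)) λ colx →
         ∑-matches (erase x col) s′ λ c → +-cancelˡ-≡ (𝟙 (s zero Fin.≟ c)) _ _
           (trans (sym (countᵐ-erase col x colx c)) (counts c))) ⟩
  ∑[ x < m ] (𝟙 (col x ≟ᵐ just (s zero)) * ∏ (λ c → count s′ c !))
    ≡⟨ *-distribʳ-sum (∏ (λ c → count s′ c !)) (λ x → 𝟙 (col x ≟ᵐ just (s zero))) ⟨
  countᵐ col (s zero) * ∏ (λ c → count s′ c !)
    ≡⟨ cong (_* ∏ (λ c → count s′ c !)) (counts (s zero)) ⟩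
  (𝟙 (s zero Fin.≟ s zero) + count s′ (s zero)) * ∏ (λ c → count s′ c !)
    ≡⟨ cong (λ a → (a + count s′ (s zero)) * ∏ (λ c → count s′ c !)) (𝟙-yes (s zero Fin.≟ s zero) refl) ⟩
  suc (count s′ (s zero)) * ∏ (λ c → count s′ c !)
    ≡⟨ ∏-!-suc (s zero) (count s′) ⟨
  ∏ (λ c → count s c !) ∎
  where
  open ≡-Reasoning
  s′ = s ∘ suc

-- Periods of cyclic words.

toℕ-mod : ∀ j n .{{_ : NonZero n}} → toℕ (j mod n) ≡ j % n
toℕ-mod j n = Fin.toℕ-fromℕ< (m%n<n j n)

mod-cong : ∀ {i j n} .{{_ : NonZero n}} → i % n ≡ j % n → i mod n ≡ j mod n
mod-cong {i} {j} {n} eq =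
  Fin.toℕ-injective (trans (toℕ-mod i n) (trans eq (sym (toℕ-mod j n))))

toℕ-mod-identity : ∀ .{{_ : NonZero n}} (i : Fin n) → toℕ i mod n ≡ i
toℕ-mod-identity {n} i =
  Fin.toℕ-injective (trans (toℕ-mod (toℕ i) n) (m<n⇒m%n≡m (Fin.toℕ<n i)))

-- Periods are handled on sequences indexed by ℕ, where they add up without reduction modulo the
-- length; `cyc` extends a cyclic word to such a sequence.
Periodic : (ℕ → X) → ℕ → Set
Periodic g ρ = ∀ j → g (j + ρ) ≡ g j

periodic-* : ∀ {g : ℕ → X} {ρ} → Periodic g ρ → ∀ a → Periodic g (a * ρ)
periodic-* {g = g} per zero    j = cong g (+-identityʳ j)
periodic-* {g = g} {ρ} per (suc a) j =
  trans (cong g (sym (+-assoc j ρ (a * ρ)))) (trans (periodic-* per a (j + ρ)) (per j))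

periodic-% : ∀ {g : ℕ → X} {ρ} .{{_ : NonZero ρ}} → Periodic g ρ → ∀ j → g (j % ρ) ≡ g j
periodic-% {g = g} {ρ} per j =
  trans (sym (periodic-* per (j / ρ) (j % ρ))) (cong g (sym (m≡m%n+[m/n]*n j ρ)))

cyc : .{{_ : NonZero n}} → (Fin n → X) → ℕ → X
cyc {n} s j = s (j mod n)

cyc-toℕ : .{{_ : NonZero n}} (s : Fin n → X) → ∀ i → cyc s (toℕ i) ≡ s i
cyc-toℕ s i = cong s (toℕ-mod-identity i)

cyc-periodic : .{{_ : NonZero n}} (s : Fin n → X) → Periodic (cyc s) n
cyc-periodic {n} s j = cong s (mod-cong ([m+n]%n≡m%n j n))

[m%n+o]%n≡[m+o]%n : ∀ m o n .{{_ : NonZero n}} → (m % n + o) % n ≡ (m + o) % n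
[m%n+o]%n≡[m+o]%n m o n = begin
  (m % n + o) % n          ≡⟨ %-distribˡ-+ (m % n) o n ⟩
  (m % n % n + o % n) % n  ≡⟨ cong (λ r → (r + o % n) % n) (m%n%n≡m%n m n) ⟩
  (m % n + o % n) % n      ≡⟨ %-distribˡ-+ m o n ⟨
  (m + o) % n              ∎
  where open ≡-Reasoning

-- `IsPeriod` tests only indices below `n`, so an arbitrary `j` is reduced modulo `n` before the
-- shift by `ρ`.
isPeriod⇒periodic : ∀ .{{_ : NonZero n}} {w : Fin n → Fin v} {ρ} →
                    IsPeriod (toℕ ∘ w) ρ → Periodic (cyc w) ρ
isPeriod⇒periodic {n} {w = w} {ρ} (_ , per) j = Fin.toℕ-injective (begin
  toℕ (w ((j + ρ) mod n))               ≡⟨ cong (toℕ ∘ w) (mod-cong ([m%n+o]%n≡[m+o]%n j ρ n)) ⟨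
  toℕ (w ((j % n + ρ) mod n))           ≡⟨ cong (λ r → toℕ (w ((r + ρ) mod n))) (toℕ-mod j n) ⟨
  toℕ (w ((toℕ (j mod n) + ρ) mod n))   ≡⟨ per′ (j mod n) ⟩
  toℕ (w (j mod n))                     ∎)
  where
  open ≡-Reasoning
  per′ : ∀ i → toℕ (w ((toℕ i + ρ) mod n)) ≡ toℕ (w i)
  per′ = per

periodic⇒isPeriod : ∀ .{{_ : NonZero n}} {w : Fin n → Fin v} {ρ} .{{_ : NonZero ρ}} →
                    Periodic (cyc w) ρ → IsPeriod (toℕ ∘ w) ρ
periodic⇒isPeriod {w = w} {ρ} per =
  >-nonZero⁻¹ ρ , λ i → cong toℕ (trans (per (toℕ i)) (cyc-toℕ w i))

-- For m ≤ n this is the prefix of length m; for m ≥ n it repeats s cyclically.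
resample : .{{_ : NonZero n}} → (Fin n → X) → Fin m → X
resample s i = cyc s (toℕ i)

-- Since `d ∣ n`, the copies of `t` fit together at the seam: reducing modulo `n` and then modulo
-- `d` is reducing modulo `d`.
cyc-resample : ∀ {d} .{{_ : NonZero n}} .{{_ : NonZero d}} → d ∣ n → (t : Fin d → X) →
               cyc (resample {m = n} t) ≗ cyc t
cyc-resample {n = n} {d = d} d∣n t j = cong t (mod-cong (begin
  toℕ (j mod n) % d  ≡⟨ cong (_% d) (toℕ-mod j n) ⟩
  j % n % d          ≡⟨ m∣n⇒o%n%m≡o%m d n j d∣n ⟩
  j % d              ∎))
  where open ≡-Reasoning

resample-periodic : ∀ {d} .{{_ : NonZero n}} .{{_ : NonZero d}} {w : Fin n → X} →
                    Periodic (cyc w) d → w ≗ resample (resample {m = d} w)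
resample-periodic {n} {d = d} {w = w} per i = begin
  w i                           ≡⟨ cyc-toℕ w i ⟨
  cyc w (toℕ i)                 ≡⟨ periodic-% per (toℕ i) ⟨
  cyc w (toℕ i % d)             ≡⟨ cong (cyc w) (toℕ-mod (toℕ i) d) ⟨
  cyc w (toℕ (toℕ i mod d))     ∎
  where open ≡-Reasoning

-- The only candidate for `t` is the prefix of `w` of length `d`, and repeating this prefix gives
-- back `w` exactly when `d` is a period.
∑-periodic-words : ∀ {d} .{{_ : NonZero n}} .{{_ : NonZero d}} → d ∣ n → (w : Fin n → Fin v) →
                   ∑ᶠ (λ (t : Fin d → Fin v) → 𝟙 (w ≗? resample t)) ≡ 𝟙 (isPeriod? (toℕ ∘ w) d)
∑-periodic-words {n} {v} {d} d∣n w = begin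
  ∑ᶠ (λ t → 𝟙 (w ≗? resample t))
    ≡⟨ sum-cong-≗ {v ^ d} (λ c → let t = finToFun c in trans
         (𝟙-cong (w ≗? resample t) ((restricted ≗? t) ×-dec isPeriod? (toℕ ∘ w) d) to from)
         (𝟙-× (restricted ≗? t) (isPeriod? (toℕ ∘ w) d))) ⟩
  ∑ᶠ (λ t → 𝟙 (restricted ≗? t) * 𝟙 (isPeriod? (toℕ ∘ w) d))
    ≡⟨ ∑ᶠ-δ restricted {λ _ → 𝟙 (isPeriod? (toℕ ∘ w) d)} (λ _ → refl) ⟩
  𝟙 (isPeriod? (toℕ ∘ w) d) ∎
  where
  open ≡-Reasoning
  restricted : Fin d → Fin v
  restricted = resample w

  to : ∀ {t : Fin d → Fin v} → w ≗ resample t → restricted ≗ t × IsPeriod (toℕ ∘ w) d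
  to {t} w≗t =
    (λ i → trans (cyc-w (toℕ i)) (cyc-toℕ t i)) ,
    periodic⇒isPeriod {w = w} (λ j → trans (cyc-w (j + d)) (trans (cyc-periodic t j) (sym (cyc-w j))))
    where
    cyc-w : cyc w ≗ cyc t
    cyc-w j = trans (w≗t (j mod n)) (cyc-resample d∣n t j)

  from : ∀ {t : Fin d → Fin v} → restricted ≗ t × IsPeriod (toℕ ∘ w) d → w ≗ resample t
  from (eq , per) i = trans (resample-periodic {w = w} (isPeriod⇒periodic per) i) (eq (toℕ i mod d))

-- Letter counts of repeated words and of the residue colouring.

∑-const : ∀ n a → ∑[ i < n ] a ≡ n * a
∑-const zero    a = refl
∑-const (suc n) a = cong (a +_) (∑-const n a)

-- The range is cut into `q` blocks of length `d`, where `combine i j` is the index `d * i + j`, and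
-- all blocks have the same sum.
∑-periodic : ∀ q d {h : ℕ → ℕ} → Periodic h d →
             ∑[ i < q * d ] h (toℕ i) ≡ q * ∑[ i < d ] h (toℕ i)
∑-periodic q d {h} per = begin
  ∑[ i < q * d ] h (toℕ i)                      ≡⟨ ∑-* q (h ∘ toℕ) ⟩
  ∑[ i < q ] ∑[ j < d ] h (toℕ (combine i j))   ≡⟨ sum-cong-≗ {q} (λ i → sum-cong-≗ {d} (shift i)) ⟩
  ∑[ i < q ] ∑[ j < d ] h (toℕ j)               ≡⟨ ∑-const q _ ⟩
  q * ∑[ i < d ] h (toℕ i)                      ∎
  where
  open ≡-Reasoning
  shift : ∀ (i : Fin q) (j : Fin d) → h (toℕ (combine i j)) ≡ h (toℕ j)
  shift i j = begin
    h (toℕ (combine i j))        ≡⟨ cong h (Fin.toℕ-combine i j) ⟩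
    h (d * toℕ i + toℕ j)        ≡⟨ cong h (+-comm (d * toℕ i) (toℕ j)) ⟩
    h (toℕ j + d * toℕ i)        ≡⟨ cong (λ x → h (toℕ j + x)) (*-comm d (toℕ i)) ⟩
    h (toℕ j + toℕ i * d)        ≡⟨ periodic-* per (toℕ i) (toℕ j) ⟩
    h (toℕ j)                    ∎

count-cong : {s t : Fin n → Fin v} → s ≗ t → ∀ c → count s c ≡ count t c
count-cong s≗t c = sum-cong-≗ λ i → cong (λ x → 𝟙 (x Fin.≟ c)) (s≗t i)

count-resample : ∀ q {d} .{{_ : NonZero d}} → n ≡ q * d → (t : Fin d → Fin v) → ∀ c →
                 count (resample {m = n} t) c ≡ q * count t c
count-resample q {d} refl t c = begin
  count (resample {m = q * d} t) c
    ≡⟨ ∑-periodic q d (λ j → cong (λ x → 𝟙 (x Fin.≟ c)) (cyc-periodic t j)) ⟩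
  q * count (resample {m = d} t) c
    ≡⟨ cong (q *_) (count-cong (cyc-toℕ t) c) ⟩
  q * count t c ∎
  where open ≡-Reasoning

colour : ∀ v .{{_ : NonZero v}} {n} → Fin n → Fin v
colour v i = suc (toℕ i) mod v

toℕ-colour : ∀ v .{{_ : NonZero v}} (f : Fin n → Fin n) → toℕ ∘ colour v ∘ f ≗ residues v f
toℕ-colour v f i = toℕ-mod (suc (toℕ (f i))) v

-- The two windows differ only in the end terms `h n` and `h 0`. The shift arises because `colour`
-- takes residues of the values 1, ..., n and not of the 0-based indices.
∑-shift : ∀ n {h : ℕ → ℕ} → h n ≡ h 0 → ∑[ i < n ] h (suc (toℕ i)) ≡ ∑[ i < n ] h (toℕ i)
∑-shift n {h} hn≡h0 = +-cancelˡ-≡ (h 0) _ _ (begin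
  h 0 + ∑[ i < n ] h (suc (toℕ i))
    ≡⟨ sum-init-last {n} (h ∘ toℕ) ⟩
  ∑[ i < n ] h (toℕ (inject₁ i)) + h (toℕ (fromℕᶠ n))
    ≡⟨ cong₂ _+_ (sum-cong-≗ {n} (cong h ∘ Fin.toℕ-inject₁)) (trans (cong h (Fin.toℕ-fromℕ n)) hn≡h0) ⟩
  ∑[ i < n ] h (toℕ i) + h 0
    ≡⟨ +-comm _ (h 0) ⟩
  h 0 + ∑[ i < n ] h (toℕ i) ∎)
  where open ≡-Reasoning

-- The values split into `m` blocks of `v` consecutive ones, and each block meets each residue class
-- once.
count-colour : ∀ m v .{{_ : NonZero v}} → n ≡ m * v → ∀ c → count {n} (colour v) c ≡ m
count-colour m v refl c = begin
  count {m * v} (colour v) c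
    ≡⟨ ∑-periodic m v (λ j → cong (λ x → 𝟙 (x Fin.≟ c)) (cyc-periodic id (suc j))) ⟩
  m * count {v} (colour v) c
    ≡⟨ cong (m *_) (∑-shift v {λ j → 𝟙 (j mod v Fin.≟ c)} (cong (λ x → 𝟙 (x Fin.≟ c)) (cyc-periodic id 0))) ⟩
  m * ∑[ i < v ] 𝟙 (toℕ i mod v Fin.≟ c)
    ≡⟨ cong (m *_) (sum-cong-≗ λ i → begin
         𝟙 (toℕ i mod v Fin.≟ c)  ≡⟨ 𝟙-cong (toℕ i mod v Fin.≟ c) (c Fin.≟ i)
                                        (λ eq → trans (sym eq) (toℕ-mod-identity i))
                                        (λ { refl → toℕ-mod-identity i }) ⟩
         𝟙 (c Fin.≟ i)            ≡⟨ *-identityʳ _ ⟨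
         𝟙 (c Fin.≟ i) * 1        ∎) ⟩
  m * ∑[ i < v ] (𝟙 (c Fin.≟ i) * 1)
    ≡⟨ cong (m *_) (∑-δ c (const 1)) ⟩
  m * 1
    ≡⟨ *-identityʳ m ⟩
  m ∎
  where open ≡-Reasoning

-- Permutations with a prescribed colouring.

injective⇒permutation : {f : Fin n → Fin n} → Injective _≡_ _≡_ f → IsPermutation f
injective⇒permutation {n} {f} inj = inj , surj n f inj
  where
  surj : ∀ n (f : Fin n → Fin n) → Injective _≡_ _≡_ f → Surjective _≡_ _≡_ f
  surj (suc n) f inj y with Fin.any? (λ x → f x Fin.≟ y)
  ... | yes (x , fx≡y) = x , λ { refl → fx≡y }
  -- Pigeonhole: if `f` missed `y`, punching out `y` would inject `Fin (suc n)` into `Fin n`.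
  ... | no  ∄x = contradiction
    (Fin.injective⇒≤ {f = λ x → punchOut (y≢f x)} λ {x} {x′} eq → inj (Fin.punchOut-injective (y≢f x) (y≢f x′) eq))
    1+n≰n
    where
    y≢f : ∀ x → y ≢ f x
    y≢f x y≡fx = ∄x (x , sym y≡fx)

count-permutation : ∀ {f : Fin n → Fin n} (s : Fin n → Fin v) → IsPermutation f → ∀ c →
                    count (s ∘ f) c ≡ count s c
count-permutation {f = f} s (inj , surj) c =
  sym (sum-permute (λ i → 𝟙 (s i Fin.≟ c)) (permutation f g f∘g≗id (λ x → inj (f∘g≗id (f x)))))
  where
  g = proj₁ ∘ surj
  f∘g≗id : ∀ y → f (g y) ≡ y
  f∘g≗id y = proj₂ (surj y) refl

Balanced : ℕ → (Fin n → Fin v) → Set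
Balanced m s = ∀ c → count s c ≡ m

balanced? : ∀ m (s : Fin n → Fin v) → Dec (Balanced m s)
balanced? m s = Fin.all? λ c → count s c ≟ m

-- A permutation coloured as `s` is an injection matching `s` under the total colouring
-- `just ∘ colour v`, so `∑-matches` gives one factor `m !` per colour. An unbalanced `s` has none,
-- because permutations preserve letter counts.
∑-fibre : ∀ m v .{{_ : NonZero v}} → n ≡ m * v → (s : Fin n → Fin v) →
          ∑ᶠ (λ (f : Fin n → Fin n) → 𝟙 (isPermutation? f) * 𝟙 ((colour v ∘ f) ≗? s)) ≡
          𝟙 (balanced? m s) * (m !) ^ v
∑-fibre {n} m v n≡mv s = ≡𝟙-* (balanced? m s) balanced unbalanced
  where
  open ≡-Reasoning
  balanced : Balanced m s →
             ∑ᶠ (λ (f : Fin n → Fin n) → 𝟙 (isPermutation? f) * 𝟙 ((colour v ∘ f) ≗? s)) ≡ (m !) ^ v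
  balanced bal = begin
    ∑ᶠ (λ (f : Fin n → Fin n) → 𝟙 (isPermutation? f) * 𝟙 ((colour v ∘ f) ≗? s))
      ≡⟨ sum-cong-≗ {n ^ n} (λ c → let f = finToFun c in begin
           𝟙 (isPermutation? f) * 𝟙 ((colour v ∘ f) ≗? s)
             ≡⟨ 𝟙-× (isPermutation? f) ((colour v ∘ f) ≗? s) ⟨
           𝟙 (isPermutation? f ×-dec ((colour v ∘ f) ≗? s))
             ≡⟨ 𝟙-cong (isPermutation? f ×-dec ((colour v ∘ f) ≗? s)) (matches? (just ∘ colour v) s f)
                  (λ (perm , eq) → proj₁ perm , λ i → cong just (eq i))
                  (λ (inj , eq) → injective⇒permutation inj , λ i → just-injective (eq i)) ⟩
           𝟙 (matches? (just ∘ colour v) s f) ∎) ⟩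
    ∑ᶠ (λ (f : Fin n → Fin n) → 𝟙 (matches? (just ∘ colour v) s f))
      ≡⟨ ∑-matches (just ∘ colour v) s (λ c → trans (count-colour m v n≡mv c) (sym (bal c))) ⟩
    ∏ (λ c → count s c !)
      ≡⟨ ∏-cong (λ c → cong _! (bal c)) ⟩
    ∏ {v} (λ _ → m !)
      ≡⟨ ∏-const v (m !) ⟩
    (m !) ^ v ∎

  unbalanced : ¬ Balanced m s →
               ∑ᶠ (λ (f : Fin n → Fin n) → 𝟙 (isPermutation? f) * 𝟙 ((colour v ∘ f) ≗? s)) ≡ 0
  unbalanced ¬bal = ∑-zero {n ^ n} _ λ c → let f = finToFun c in trans
    (sym (𝟙-× (isPermutation? f) ((colour v ∘ f) ≗? s)))
    (𝟙-no (isPermutation? f ×-dec ((colour v ∘ f) ≗? s)) λ (perm , eq) → ¬bal λ c → begin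
      count s c               ≡⟨ count-cong eq c ⟨
      count (colour v ∘ f) c  ≡⟨ count-permutation (colour v) perm c ⟩
      count {n} (colour v) c  ≡⟨ count-colour m v n≡mv c ⟩
      m                       ∎)

-- With a single colour, every injection matches the constant word, and `∑-matches` applies once
-- more.
∑-permutations : ∀ n → ∑ᶠ (λ (f : Fin n → Fin n) → 𝟙 (isPermutation? f)) ≡ n !
∑-permutations n = begin
  ∑ᶠ (λ (f : Fin n → Fin n) → 𝟙 (isPermutation? f))
    ≡⟨ sum-cong-≗ {n ^ n} (λ c → let f = finToFun c in
         𝟙-cong (isPermutation? f) (matches? monochrome (const zero) f)
           (λ perm → proj₁ perm , λ _ → refl) (injective⇒permutation ∘ proj₁)) ⟩
  ∑ᶠ (λ (f : Fin n → Fin n) → 𝟙 (matches? monochrome (const zero) f))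
    ≡⟨ ∑-matches {n = n} monochrome (const zero) (λ _ → refl) ⟩
  (∑[ i < n ] 1) ! * 1
    ≡⟨ *-identityʳ _ ⟩
  (∑[ i < n ] 1) !
    ≡⟨ cong _! (trans (∑-const n 1) (*-identityʳ n)) ⟩
  n ! ∎
  where
  open ≡-Reasoning
  monochrome : Fin n → Maybe (Fin 1)
  monochrome _ = just zero

-- The number of permutations whose residues have a given period.

isPeriod-cong : {s t : Fin n → ℕ} {ρ : ℕ} → s ≗ t → IsPeriod s ρ → IsPeriod t ρ
isPeriod-cong s≗t (0<ρ , per) = 0<ρ , λ i → trans (sym (s≗t _)) (trans (per i) (s≗t i))

-- For `d = n / q` this is the number A_q; the period `d` need not be the least one.
periodCount : ∀ v .{{_ : NonZero v}} → ℕ → ℕ → ℕ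
periodCount v n d = ∑ᶠ (λ (f : Fin n → Fin n) → 𝟙 (isPermutation? f) * 𝟙 (isPeriod? (residues v f) d))

module _ {v k q d m n} .{{_ : NonZero v}} .{{_ : NonZero n}} .{{_ : NonZero d}} .{{_ : NonZero q}}
         (n≡qd : n ≡ q * d) (n≡kv : n ≡ k * v) (k≡qm : k ≡ q * m) where

  balanced-resample : (t : Fin d → Fin v) → 𝟙 (balanced? k (resample {m = n} t)) ≡ 𝟙 (balanced? m t)
  balanced-resample t = 𝟙-cong (balanced? k (resample {m = n} t)) (balanced? m t)
    (λ bal c → *-cancelˡ-≡ _ _ q (trans (sym (count-resample q n≡qd t c)) (trans (bal c) k≡qm)))
    (λ bal c → trans (count-resample q n≡qd t c) (trans (cong (q *_) (bal c)) (sym k≡qm)))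

  -- Double counting: the permutations are sorted by the word `t` that their colouring repeats, and
  -- after exchanging the sums `∑-fibre` evaluates each class.
  periodCount-words : periodCount v n d ≡ ∑ᶠ (λ (t : Fin d → Fin v) → 𝟙 (balanced? m t)) * (k !) ^ v
  periodCount-words = begin
    ∑[ c < n ^ n ] (perm c * 𝟙 (isPeriod? (residues v (finToFun {n} {n} c)) d))
      ≡⟨ sum-cong-≗ {n ^ n} (λ c → cong (perm c *_) (by-words (finToFun c))) ⟩
    ∑[ c < n ^ n ] (perm c * ∑[ t < v ^ d ] fits c t)
      ≡⟨ sum-cong-≗ {n ^ n} (λ c → *-distribˡ-sum (perm c) (fits c)) ⟩
    ∑[ c < n ^ n ] ∑[ t < v ^ d ] (perm c * fits c t)
      ≡⟨ ∑-comm {n ^ n} {v ^ d} (λ c t → perm c * fits c t) ⟩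
    ∑[ t < v ^ d ] ∑[ c < n ^ n ] (perm c * fits c t)
      ≡⟨ sum-cong-≗ {v ^ d} (λ t → trans (∑-fibre k v n≡kv (resample (finToFun t)))
           (cong (_* (k !) ^ v) (balanced-resample (finToFun t)))) ⟩
    ∑[ t < v ^ d ] (𝟙 (balanced? m (finToFun {v} {d} t)) * (k !) ^ v)
      ≡⟨ *-distribʳ-sum ((k !) ^ v) (λ t → 𝟙 (balanced? m (finToFun {v} {d} t))) ⟨
    ∑[ t < v ^ d ] 𝟙 (balanced? m (finToFun {v} {d} t)) * (k !) ^ v ∎
    where
    open ≡-Reasoning
    perm : Fin (n ^ n) → ℕ
    perm c = 𝟙 (isPermutation? (finToFun {n} {n} c))

    fits : Fin (n ^ n) → Fin (v ^ d) → ℕ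
    fits c t = 𝟙 ((colour v ∘ finToFun {n} {n} c) ≗? resample (finToFun {v} {d} t))

    by-words : ∀ f → 𝟙 (isPeriod? (residues v {n} f) d) ≡
                     ∑ᶠ (λ (t : Fin d → Fin v) → 𝟙 ((colour v ∘ f) ≗? resample t))
    by-words f = trans
      (𝟙-cong (isPeriod? (residues v f) d) (isPeriod? (toℕ ∘ colour v ∘ f) d)
        (isPeriod-cong (sym ∘ toℕ-colour v f)) (isPeriod-cong (toℕ-colour v f)))
      (sym (∑-periodic-words (divides q n≡qd) (colour v ∘ f)))

isPeriod-length : ∀ .{{_ : NonZero n}} (s : Fin n → ℕ) → IsPeriod s n
isPeriod-length {n} s = >-nonZero⁻¹ n , per
  where
  per : ∀ i → cyc s (toℕ i + n) ≡ s i
  per i = trans (cyc-periodic s (toℕ i)) (cyc-toℕ s i)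

periodCount-self : ∀ v .{{_ : NonZero v}} n .{{_ : NonZero n}} → periodCount v n n ≡ n !
periodCount-self v n = trans
  (sum-cong-≗ {n ^ n} λ c → let f = finToFun c in
    trans (cong (𝟙 (isPermutation? f) *_) (𝟙-yes (isPeriod? (residues v f) n) (isPeriod-length (residues v f))))
          (*-identityʳ _))
  (∑-permutations n)

-- The number of balanced words of length `d` is eliminated by using `periodCount-words` twice: at
-- length `n`, and at length `d` with `q = 1`, where every permutation counts.
periodCount-! : ∀ {v k q d m n} .{{_ : NonZero v}} .{{_ : NonZero n}} .{{_ : NonZero d}} .{{_ : NonZero q}} →
                n ≡ q * d → n ≡ k * v → k ≡ q * m → d ≡ m * v →
                periodCount v n d * (m !) ^ v ≡ d ! * (k !) ^ v
periodCount-! {v} {k} {q} {d} {m} {n} n≡qd n≡kv k≡qm d≡mv = begin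
  periodCount v n d * (m !) ^ v                ≡⟨ cong (_* (m !) ^ v) (periodCount-words n≡qd n≡kv k≡qm) ⟩
  words * (k !) ^ v * (m !) ^ v                ≡⟨ *-assoc words _ _ ⟩
  words * ((k !) ^ v * (m !) ^ v)              ≡⟨ cong (words *_) (*-comm ((k !) ^ v) _) ⟩
  words * ((m !) ^ v * (k !) ^ v)              ≡⟨ *-assoc words _ _ ⟨
  words * (m !) ^ v * (k !) ^ v                ≡⟨ cong (_* (k !) ^ v)
                                                    (periodCount-words {q = 1} (sym (+-identityʳ d)) d≡mv (sym (+-identityʳ m))) ⟨
  periodCount v d d * (k !) ^ v                ≡⟨ cong (_* (k !) ^ v) (periodCount-self v d) ⟩
  d ! * (k !) ^ v                              ∎
  where
  open ≡-Reasoning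
  words = ∑ᶠ (λ (t : Fin d → Fin v) → 𝟙 (balanced? m t))

-- Upper bounds for the number of full-period permutations.

length-filter-tabulate : ∀ {B : X → Set} (B? : Decidable B) (f : Fin n → X) →
                         length (filter B? (tabulate f)) ≡ ∑[ i < n ] 𝟙 (B? (f i))
length-filter-tabulate {n = zero}  B? f = refl
length-filter-tabulate {n = suc n} B? f with does (B? (f zero))
... | true  = cong suc (length-filter-tabulate B? (f ∘ suc))
... | false = length-filter-tabulate B? (f ∘ suc)

fullPeriodCount-∑ : ∀ v .{{_ : NonZero v}} n →
                    fullPeriodCount v n ≡ ∑ᶠ (λ (f : Fin n → Fin n) → 𝟙 (fullPeriodPermutation? v f))
fullPeriodCount-∑ v n = length-filter-tabulate (λ c → fullPeriodPermutation? v (finToFun {n} {n} c)) id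

𝟙-disjoint : (P? : Dec P) (Q? : Dec Q) (R? : Dec R) → (P → R) → (Q → R) → (P → ¬ Q) →
             𝟙 P? + 𝟙 Q? ≤ 𝟙 R?
𝟙-disjoint (yes p) Q? R? p⇒r _ p⇒¬q =
  ≤-reflexive (trans (cong suc (𝟙-no Q? (p⇒¬q p))) (sym (𝟙-yes R? (p⇒r p))))
𝟙-disjoint (no _) Q? R? _ q⇒r _ = 𝟙-mono Q? R? q⇒r

-- A period `d < n` excludes least period `n`, so two disjoint sets of permutations are counted on
-- the left.
fullPeriodCount-upper : ∀ v .{{_ : NonZero v}} n {d} → d < n →
                        fullPeriodCount v n + periodCount v n d ≤ n !
fullPeriodCount-upper v n {d} d<n = begin
  fullPeriodCount v n + periodCount v n d
    ≡⟨ cong (_+ periodCount v n d) (fullPeriodCount-∑ v n) ⟩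
  ∑[ c < n ^ n ] full (finToFun c) + periodCount v n d
    ≡⟨ ∑-distrib-+ {n ^ n} (full ∘ finToFun) _ ⟨
  ∑[ c < n ^ n ] (full (finToFun c) + 𝟙 (isPermutation? (finToFun {n} {n} c)) * 𝟙 (isPeriod? (residues v (finToFun {n} {n} c)) d))
    ≤⟨ ∑-mono {n ^ n} (λ c → bound (finToFun c)) ⟩
  ∑[ c < n ^ n ] 𝟙 (isPermutation? (finToFun {n} {n} c))
    ≡⟨ ∑-permutations n ⟩
  n ! ∎
  where
  open ≤-Reasoning
  full : (Fin n → Fin n) → ℕ
  full f = 𝟙 (fullPeriodPermutation? v f)

  bound : ∀ f → full f + 𝟙 (isPermutation? f) * 𝟙 (isPeriod? (residues v f) d) ≤ 𝟙 (isPermutation? f)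
  bound f = begin
    full f + 𝟙 (isPermutation? f) * 𝟙 (isPeriod? (residues v f) d)
      ≡⟨ cong (full f +_) (𝟙-× (isPermutation? f) (isPeriod? (residues v f) d)) ⟨
    full f + 𝟙 (isPermutation? f ×-dec isPeriod? (residues v f) d)
      ≤⟨ 𝟙-disjoint (fullPeriodPermutation? v f) (isPermutation? f ×-dec isPeriod? (residues v f) d) (isPermutation? f)
           proj₁ proj₁ (λ (_ , _ , least) (_ , per) → least d<n per) ⟩
    𝟙 (isPermutation? f) ∎

fullPeriodCount≤! : ∀ v .{{_ : NonZero v}} n → fullPeriodCount v n ≤ n !
fullPeriodCount≤! v n = begin
  fullPeriodCount v n
    ≡⟨ fullPeriodCount-∑ v n ⟩
  ∑ᶠ (λ (f : Fin n → Fin n) → 𝟙 (fullPeriodPermutation? v f))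
    ≤⟨ ∑-mono {n ^ n} (λ c → 𝟙-mono (fullPeriodPermutation? v (finToFun {n} {n} c)) (isPermutation? (finToFun {n} {n} c)) proj₁) ⟩
  ∑ᶠ (λ (f : Fin n → Fin n) → 𝟙 (isPermutation? f))
    ≡⟨ ∑-permutations n ⟩
  n ! ∎
  where open ≤-Reasoning

-- Short periods, prime divisors and the lower bound.

periodic-gcd : ∀ {g : ℕ → X} {a b} → Periodic g a → Periodic g b →
               ∃ λ d → d ∣ a × d ∣ b × Periodic g d
periodic-gcd {g = g} {a} {b} per-a per-b with Bézout.lemma a b
... | Bézout.result d isGCD identity =
  d , proj₁ commonDivisor , proj₂ commonDivisor , periodic identity
  where
  open GCD.GCD isGCD using (commonDivisor)
  open ≡-Reasoning
  -- Bézout's identity is kept free of subtraction: a shift by `d` may be followed by one by `x`,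
  -- and together they are a shift by `y`.
  bezout : ∀ {x y} → Periodic g x → Periodic g y → d + x ≡ y → Periodic g d
  bezout {x} {y} per-x per-y d+x≡y j = begin
    g (j + d)        ≡⟨ per-x (j + d) ⟨
    g (j + d + x)    ≡⟨ cong g (+-assoc j d x) ⟩
    g (j + (d + x))  ≡⟨ cong (g ∘ (j +_)) d+x≡y ⟩
    g (j + y)        ≡⟨ per-y j ⟩
    g j              ∎

  periodic : Bézout.Identity d a b → Periodic g d
  periodic (Bézout.+- x y eq) = bezout (periodic-* per-b y) (periodic-* per-a x) eq
  periodic (Bézout.-+ x y eq) = bezout (periodic-* per-a x) (periodic-* per-b y) eq

∃-primeDivisor : ∀ {n} → 1 < n → ∃ (PrimeDivisor n)
∃-primeDivisor {n} 1<n = go factors isFactorisation factorsPrime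
  where
  open PrimeFactorisation (factorise n {{>-nonZero (<-trans z<s 1<n)}})
  go : ∀ ps → n ≡ product ps → All Prime ps → ∃ (PrimeDivisor n)
  go []       refl _        = contradiction 1<n (n≮n 1)
  go (p ∷ ps) n≡   (pr ∷ _) = p , pr , divides (product ps) (trans n≡ (*-comm p (product ps)))

-- The colouring is a word of length `d` repeated `q` times, so a letter occurs a multiple of `q`
-- times in it, but also `k` times. Any letter would do; `0 mod v` is taken.
periodic⇒∣ : ∀ {v k q d n} .{{_ : NonZero v}} .{{_ : NonZero n}} .{{_ : NonZero d}} →
      n ≡ q * d → n ≡ k * v → {f : Fin n → Fin n} → IsPermutation f →
      Periodic (cyc (colour v ∘ f)) d → q ∣ k
periodic⇒∣ {v} {k} {q} {d} {n} n≡qd n≡kv {f} perm per = divides (count restricted c) (begin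
  k                                      ≡⟨ count-colour k v n≡kv c ⟨
  count {n} (colour v) c                 ≡⟨ count-permutation (colour v) perm c ⟨
  count (colour v ∘ f) c                 ≡⟨ count-cong (resample-periodic {w = colour v ∘ f} per) c ⟩
  count (resample {m = n} restricted) c  ≡⟨ count-resample q n≡qd restricted c ⟩
  q * count restricted c                 ≡⟨ *-comm q _ ⟩
  count restricted c * q                 ∎)
  where
  open ≡-Reasoning
  c = 0 mod v
  restricted : Fin d → Fin v
  restricted = resample (colour v ∘ f)

-- The gcd `g` of a smaller period with `n` is again a period, and `n = e * g` with `1 < e`. For a
-- prime `q` dividing `e`, the number `n / q` is a multiple of `g`, hence a period. The prime is
-- returned as `suc i`, as in `∑primeDivisors`.
shortPeriod : ∀ {v k n} .{{_ : NonZero v}} .{{_ : NonZero n}} → n ≡ k * v →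
              {f : Fin n → Fin n} → IsPermutation f → ¬ FullPeriodPermutation v f →
              ∃ λ i → PrimeDivisor k (suc i) × IsPeriod (residues v f) (n / suc i)
shortPeriod {v} {k} {n} n≡kv {f} perm ¬full with anyUpTo? (isPeriod? (residues v f)) n
... | no ∄σ = contradiction (perm , isPeriod-length (residues v f) , λ {σ} σ<n per → ∄σ (σ , σ<n , per)) ¬full
... | yes (σ , σ<n , perσ) =
  let per-σ = isPeriod⇒periodic (isPeriod-cong (sym ∘ toℕ-colour v f) perσ)
      g , g∣σ , divides e n≡eg , per-g = periodic-gcd per-σ (cyc-periodic (colour v ∘ f))
      g<n : g < n
      g<n = ≤-<-trans (∣⇒≤ {{>-nonZero (proj₁ perσ)}} g∣σ) σ<n
      q , prime-q , divides e′ e≡e′q = ∃-primeDivisor (1<e g e g<n n≡eg)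
  in reduce q prime-q (e′ * g) (n≡q[e′g] q e e′ g n≡eg e≡e′q) (periodic-* per-g e′)
  where
  1<e : ∀ g e → g < n → n ≡ e * g → 1 < e
  1<e g zero            g<n refl = contradiction g<n λ ()
  1<e g (suc zero)      g<n refl = contradiction g<n (≤⇒≯ (≤-reflexive (*-identityˡ g)))
  1<e g (suc (suc e))   g<n _    = s≤s (s≤s z≤n)

  n≡q[e′g] : ∀ q e e′ g → n ≡ e * g → e ≡ e′ * q → n ≡ q * (e′ * g)
  n≡q[e′g] q e e′ g n≡eg e≡e′q = begin
    n             ≡⟨ n≡eg ⟩
    e * g         ≡⟨ cong (_* g) (trans e≡e′q (*-comm e′ q)) ⟩
    q * e′ * g    ≡⟨ *-assoc q e′ g ⟩
    q * (e′ * g)  ∎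
    where open ≡-Reasoning

  reduce : ∀ q → Prime q → ∀ d → n ≡ q * d → Periodic (cyc (colour v ∘ f)) d →
           ∃ λ i → PrimeDivisor k (suc i) × IsPeriod (residues v f) (n / suc i)
  reduce zero    prime-q d n≡qd per = contradiction n≡qd (≢-nonZero⁻¹ n)
  reduce (suc i) prime-q d n≡qd per =
    i , (prime-q , periodic⇒∣ {{it}} {{it}} {{d≢0}} n≡qd n≡kv perm per) ,
    subst (IsPeriod (residues v f)) d≡n/q
      (isPeriod-cong (toℕ-colour v f) (periodic⇒isPeriod {{it}} {{d≢0}} per))
    where
    d≢0 : NonZero d
    d≢0 = m*n≢0⇒n≢0 (suc i) {{≢-nonZero (≢-nonZero⁻¹ n ∘ trans n≡qd)}}
    d≡n/q : d ≡ n / suc i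
    d≡n/q = sym (trans (cong (_/ suc i) (trans n≡qd (*-comm (suc i) d))) (m*n/n≡m d (suc i)))

primeDivisorIndices : ℕ → List ℕ
primeDivisorIndices k = filter (λ i → primeDivisor? k (suc i)) (upTo k)

periodCountSum : ∀ v .{{_ : NonZero v}} → ℕ → List ℕ → ℕ
periodCountSum v n is = sumᴸ (map (λ i → periodCount v n (n / suc i)) is)

∈⇒≤sum-map : (h : ℕ → ℕ) {is : List ℕ} {i : ℕ} → i ∈ is → h i ≤ sumᴸ (map h is)
∈⇒≤sum-map h (here refl)       = m≤m+n _ _
∈⇒≤sum-map h (there {x = j} i∈) = ≤-trans (∈⇒≤sum-map h i∈) (m≤n+m _ (h j))

sum-map-∑ : (h : ℕ → Fin n → ℕ) (is : List ℕ) →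
            ∑[ j < n ] sumᴸ (map (λ i → h i j) is) ≡ sumᴸ (map (λ i → sum (h i)) is)
sum-map-∑ {n} h []       = ∑-zero {n} (λ _ → 0) λ _ → refl
sum-map-∑ {n} h (i ∷ is) = trans (∑-distrib-+ {n} (h i) _) (cong (sum (h i) +_) (sum-map-∑ h is))

-- Union bound: by `shortPeriod`, a permutation without full period is counted by at least one
-- summand.
fullPeriodCount-lower : ∀ {v k n} .{{_ : NonZero v}} .{{_ : NonZero n}} → n ≡ k * v →
                        n ! ≤ fullPeriodCount v n + periodCountSum v n (primeDivisorIndices k)
fullPeriodCount-lower {v} {k} {n} n≡kv = begin
  n !
    ≡⟨ ∑-permutations n ⟨
  ∑[ c < n ^ n ] 𝟙 (isPermutation? (finToFun {n} {n} c))
    ≤⟨ ∑-mono {n ^ n} (λ c → bound (finToFun c)) ⟩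
  ∑[ c < n ^ n ] (full (finToFun c) + sumᴸ (map (λ i → short i (finToFun c)) is))
    ≡⟨ ∑-distrib-+ {n ^ n} (full ∘ finToFun) _ ⟩
  ∑ᶠ full + ∑[ c < n ^ n ] sumᴸ (map (λ i → short i (finToFun c)) is)
    ≡⟨ cong₂ _+_ (sym (fullPeriodCount-∑ v n)) (sum-map-∑ {n ^ n} (λ i → short i ∘ finToFun) is) ⟩
  fullPeriodCount v n + periodCountSum v n is ∎
  where
  open ≤-Reasoning
  is = primeDivisorIndices k

  full : (Fin n → Fin n) → ℕ
  full f = 𝟙 (fullPeriodPermutation? v f)

  short : ℕ → (Fin n → Fin n) → ℕ
  short i f = 𝟙 (isPermutation? f) * 𝟙 (isPeriod? (residues v f) (n / suc i))

  k≢0 : NonZero k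
  k≢0 = ≢-nonZero λ { refl → ≢-nonZero⁻¹ n n≡kv }

  bound′ : ∀ f (perm? : Dec (IsPermutation f)) (full? : Dec (FullPeriodPermutation v f)) →
           𝟙 perm? ≤ 𝟙 full? + sumᴸ (map (λ i → short i f) is)
  bound′ f (no _)     _       = z≤n
  bound′ f (yes _)    (yes _) = s≤s z≤n
  bound′ f (yes perm) (no ¬full) with i , (prime-q , q∣k) , per ← shortPeriod n≡kv perm ¬full = begin
    1
      ≡⟨ cong₂ _*_ (𝟙-yes (isPermutation? f) perm) (𝟙-yes (isPeriod? (residues v f) (n / suc i)) per) ⟨
    short i f
      ≤⟨ ∈⇒≤sum-map (λ i → short i f)
           (∈-filter⁺ (λ i → primeDivisor? k (suc i)) (∈-upTo⁺ (∣⇒≤ {{k≢0}} q∣k)) (prime-q , q∣k)) ⟩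
    sumᴸ (map (λ i → short i f) is) ∎

  bound : ∀ f → 𝟙 (isPermutation? f) ≤ full f + sumᴸ (map (λ i → short i f) is)
  bound f = bound′ f (isPermutation? f) (fullPeriodPermutation? v f)

-- Growth of factorial quotients.

^-!-≤ : ∀ k w x → k ≤ x → suc k ^ w * x ! ≤ (w + x) !
^-!-≤ k zero    x k≤x = ≤-reflexive (*-identityˡ (x !))
^-!-≤ k (suc w) x k≤x = begin
  suc k * suc k ^ w * x !       ≡⟨ *-assoc (suc k) (suc k ^ w) (x !) ⟩
  suc k * (suc k ^ w * x !)     ≤⟨ *-mono-≤ (s≤s (≤-trans k≤x (m≤n+m x w))) (^-!-≤ k w x k≤x) ⟩
  suc (w + x) * (w + x) !       ∎
  where open ≤-Reasoning

-- Each of the `v` new factors on the right is at least `suc k`, and the largest, `suc k * v`, is at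
-- least `suc k * 2`.
!-step : ∀ k v → 2 ≤ v → 2 * suc k ^ v * (k * v) ! ≤ (suc k * v) !
!-step k (suc w) 2≤v = begin
  2 * (suc k * suc k ^ w) * (k * suc w) !       ≡⟨ regroup (suc k) (suc k ^ w) ((k * suc w) !) ⟩
  suc k * 2 * (suc k ^ w * (k * suc w) !)       ≤⟨ *-mono-≤ (*-monoʳ-≤ (suc k) 2≤v) (^-!-≤ k w (k * suc w) (m≤m*n k (suc w))) ⟩
  suc (w + k * suc w) * (w + k * suc w) !       ∎
  where
  open ≤-Reasoning
  regroup : ∀ a b c → 2 * (a * b) * c ≡ a * 2 * (b * c)
  regroup = solve 3 (λ a b c → con 2 :* (a :* b) :* c := a :* con 2 :* (b :* c)) refl
    where open +-*-Solver

^-distribʳ-* : ∀ a b n → (a * b) ^ n ≡ a ^ n * b ^ n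
^-distribʳ-* a b zero    = refl
^-distribʳ-* a b (suc n) = trans (cong (a * b *_) (^-distribʳ-* a b n)) (regroup a b (a ^ n) (b ^ n))
  where
  regroup : ∀ a b c d → a * b * (c * d) ≡ a * c * (b * d)
  regroup = solve 4 (λ a b c d → a :* b :* (c :* d) := a :* c :* (b :* d)) refl
    where open +-*-Solver

-- Cross-multiplied form of `h` successive doublings of (k v)!/(k!)^v, from `k = m` to `k = h + m`.
!-ratio : ∀ h m v → 2 ≤ v → (m * v) ! * ((h + m) !) ^ v * 2 ^ h ≤ ((h + m) * v) ! * (m !) ^ v
!-ratio zero    m v 2≤v = ≤-reflexive (*-identityʳ _)
!-ratio (suc h) m v 2≤v = begin
  (m * v) ! * (suc k * k !) ^ v * (2 * 2 ^ h)
    ≡⟨ cong (λ x → (m * v) ! * x * (2 * 2 ^ h)) (^-distribʳ-* (suc k) (k !) v) ⟩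
  (m * v) ! * (suc k ^ v * (k !) ^ v) * (2 * 2 ^ h)
    ≡⟨ regroup ((m * v) !) (suc k ^ v) ((k !) ^ v) (2 ^ h) ⟩
  2 * suc k ^ v * ((m * v) ! * (k !) ^ v * 2 ^ h)
    ≤⟨ *-monoʳ-≤ (2 * suc k ^ v) (!-ratio h m v 2≤v) ⟩
  2 * suc k ^ v * ((k * v) ! * (m !) ^ v)
    ≡⟨ *-assoc (2 * suc k ^ v) _ _ ⟨
  2 * suc k ^ v * (k * v) ! * (m !) ^ v
    ≤⟨ *-monoˡ-≤ ((m !) ^ v) (!-step k v 2≤v) ⟩
  (suc k * v) ! * (m !) ^ v ∎
  where
  open ≤-Reasoning
  k = h + m
  regroup : ∀ a b c d → a * (b * c) * (2 * d) ≡ 2 * b * (a * c * d)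
  regroup = solve 4 (λ a b c d → a :* (b :* c) :* (con 2 :* d) := con 2 :* b :* (a :* c :* d)) refl
    where open +-*-Solver

n<2^n : ∀ n → n < 2 ^ n
n<2^n zero    = s≤s z≤n
n<2^n (suc n) = begin-strict
  suc n          ≡⟨ +-comm 1 n ⟩
  n + 1          <⟨ +-mono-<-≤ (n<2^n n) (m^n>0 2 n) ⟩
  2 ^ n + 2 ^ n  ≡⟨ cong (λ x → 2 ^ n + x) (+-identityʳ (2 ^ n)) ⟨
  2 * 2 ^ n      ∎
  where open ≤-Reasoning

-- At the starting value `2 * (2 + b)` the right side is a square: one factor `2 ^ (2 + b)`
-- dominates `2 + b`, the other `4 * b`. Each further step at most doubles the left side and doubles
-- the right.
2hb≤2^h : ∀ b e → 2 * (e + 2 * (2 + b)) * b ≤ 2 ^ (e + 2 * (2 + b))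
2hb≤2^h b zero = begin
  2 * (2 * (2 + b)) * b        ≡⟨ regroup (2 + b) b ⟩
  (2 + b) * (2 * (2 * b))      ≤⟨ *-mono-≤ (<⇒≤ (n<2^n (2 + b))) (*-monoʳ-≤ 2 (*-monoʳ-≤ 2 (<⇒≤ (n<2^n b)))) ⟩
  2 ^ (2 + b) * 2 ^ (2 + b)    ≡⟨ ^-distribˡ-+-* 2 (2 + b) (2 + b) ⟨
  2 ^ (2 + b + (2 + b))        ≡⟨ cong (λ x → 2 ^ (2 + b + x)) (+-identityʳ (2 + b)) ⟨
  2 ^ (2 * (2 + b))            ∎
  where
  open ≤-Reasoning
  regroup : ∀ a b → 2 * (2 * a) * b ≡ a * (2 * (2 * b))
  regroup = solve 2 (λ a b → con 2 :* (con 2 :* a) :* b := a :* (con 2 :* (con 2 :* b))) refl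
    where open +-*-Solver
2hb≤2^h b (suc e) = begin
  2 * suc h * b       ≤⟨ *-monoˡ-≤ b (*-monoʳ-≤ 2 (+-monoˡ-≤ h 1≤h)) ⟩
  2 * (h + h) * b     ≡⟨ regroup h b ⟩
  2 * (2 * h * b)     ≤⟨ *-monoʳ-≤ 2 (2hb≤2^h b e) ⟩
  2 * 2 ^ h           ∎
  where
  open ≤-Reasoning
  h = e + 2 * (2 + b)
  1≤h : 1 ≤ h
  1≤h = ≤-trans (s≤s z≤n) (m≤n+m (2 * (2 + b)) e)
  regroup : ∀ h b → 2 * (h + h) * b ≡ 2 * (2 * h * b)
  regroup = solve 2 (λ h b → con 2 :* (h :+ h) :* b := con 2 :* (con 2 :* h :* b)) refl
    where open +-*-Solver

-- Twice the starting value in `2hb≤2^h`, because the exponent `h` is only known to be at least half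
-- of `k`.
threshold : ℕ → ℕ
threshold b = 2 * (2 * (2 + b))

kb≤2^h : ∀ b {k h} → threshold b ≤ k → k ≤ 2 * h → k * b ≤ 2 ^ h
kb≤2^h b {k} {h} K≤k k≤2h = begin
  k * b      ≤⟨ *-monoˡ-≤ b k≤2h ⟩
  2 * h * b  ≤⟨ subst (λ h → 2 * h * b ≤ 2 ^ h) (m∸n+n≡m (*-cancelˡ-≤ {2 * (2 + b)} {h} 2 (≤-trans K≤k k≤2h)))
                  (2hb≤2^h b (h ∸ 2 * (2 + b))) ⟩
  2 ^ h      ∎
  where open ≤-Reasoning

-- Evaluation and size of A_q for the divisors of k.

module PrimeDivisorCount (v : ℕ) .{{_ : NonZero v}} {n} .{{_ : NonZero n}} (n≡kv : n ≡ n / v * v)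
                         (q : ℕ) .{{_ : NonZero q}} (q∣k : q ∣ n / v) where
  private
    k = n / v
    d = n / q
    μ = k / q

  k≡qμ : k ≡ q * μ
  k≡qμ = sym (m*[n/m]≡n q∣k)

  n≡qd : n ≡ q * d
  n≡qd = sym (m*[n/m]≡n (∣-trans q∣k (divides v (trans n≡kv (*-comm k v)))))

  d≡μv : d ≡ μ * v
  d≡μv = *-cancelˡ-≡ _ _ q (begin
    q * d        ≡⟨ n≡qd ⟨
    n            ≡⟨ n≡kv ⟩
    k * v        ≡⟨ cong (_* v) k≡qμ ⟩
    q * μ * v    ≡⟨ *-assoc q μ v ⟩
    q * (μ * v)  ∎)
    where open ≡-Reasoning

  identity : periodCount v n d * (μ !) ^ v ≡ d ! * (k !) ^ v
  identity = periodCount-! n≡qd n≡kv k≡qμ d≡μv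
    where
    instance
      d≢0 : NonZero d
      d≢0 = m*n≢0⇒n≢0 q {{≢-nonZero λ qd≡0 → ≢-nonZero⁻¹ n (trans n≡qd qd≡0)}}

  -- The exponent `h = k ∸ μ` is at least half of `k` since `2 ≤ q`, so `2 ^ h` exceeds `k * b`. The
  -- factor `k` is there to absorb the number of summands in `periodCountSum-bound`.
  bound : 2 ≤ v → 2 ≤ q → ∀ {b} → threshold b ≤ k → periodCount v n d * (k * b) ≤ n !
  bound 2≤v 2≤q {b} K≤k = *-cancelʳ-≤ _ _ ((μ !) ^ v) {{m^n≢0 (μ !) v {{μ !≢0}}}} (begin
    A * (k * b) * (μ !) ^ v             ≤⟨ *-monoˡ-≤ ((μ !) ^ v) (*-monoʳ-≤ A (kb≤2^h b {h = h} K≤k k≤2h)) ⟩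
    A * 2 ^ h * (μ !) ^ v               ≡⟨ regroup A (2 ^ h) ((μ !) ^ v) ⟩
    A * (μ !) ^ v * 2 ^ h               ≡⟨ cong (_* 2 ^ h) identity ⟩
    d ! * (k !) ^ v * 2 ^ h             ≡⟨ cong₂ (λ x y → x ! * (y !) ^ v * 2 ^ h) d≡μv k≡h+μ ⟩
    (μ * v) ! * ((h + μ) !) ^ v * 2 ^ h ≤⟨ !-ratio h μ v 2≤v ⟩
    ((h + μ) * v) ! * (μ !) ^ v         ≡⟨ cong (λ x → x ! * (μ !) ^ v) (trans n≡kv (cong (_* v) k≡h+μ)) ⟨
    n ! * (μ !) ^ v                     ∎)
    where
    open ≤-Reasoning
    A = periodCount v n d
    h = k ∸ μ
    k≡h+μ : k ≡ h + μ
    k≡h+μ = sym (m∸n+n≡m (m/n≤m k q))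

    μ≤h : μ ≤ h
    μ≤h = m+n≤o⇒m≤o∸n μ (begin
      μ + μ  ≡⟨ cong (μ +_) (+-identityʳ μ) ⟨
      2 * μ  ≤⟨ *-monoˡ-≤ μ 2≤q ⟩
      q * μ  ≡⟨ k≡qμ ⟨
      k      ∎)

    k≤2h : k ≤ 2 * h
    k≤2h = begin
      k        ≡⟨ k≡h+μ ⟩
      h + μ    ≤⟨ +-monoʳ-≤ h μ≤h ⟩
      h + h    ≡⟨ cong (h +_) (+-identityʳ h) ⟨
      2 * h    ∎

    regroup : ∀ a b c → a * b * c ≡ a * c * b
    regroup = solve 3 (λ a b c → a :* b :* c := a :* c :* b) refl
      where open +-*-Solver

primeDivisorIndices-sound : ∀ k → All (λ i → PrimeDivisor k (suc i)) (primeDivisorIndices k)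
primeDivisorIndices-sound k = all-filter (λ i → primeDivisor? k (suc i)) (upTo k)

prime⇒1< : ∀ {q} → Prime q → 1 < q
prime⇒1< {q} pr = nonTrivial⇒n>1 q {{prime⇒nonTrivial pr}}

-- Crude but sufficient: there are at most `k` prime divisors, and each summand times `k * b` is at
-- most `n !`.
periodCountSum-bound : ∀ v .{{_ : NonZero v}} {n} .{{_ : NonZero n}} → n ≡ n / v * v → 2 ≤ v →
                       ∀ b → threshold b ≤ n / v →
                       periodCountSum v n (primeDivisorIndices (n / v)) * b ≤ n !
periodCountSum-bound v {n} n≡kv 2≤v b K≤k = *-cancelˡ-≤ k {{k≢0}} (begin
  k * (periodCountSum v n is * b)   ≡⟨ regroup k (periodCountSum v n is) b ⟩
  periodCountSum v n is * (k * b)   ≤⟨ go is (primeDivisorIndices-sound k) ⟩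
  length is * n !                   ≤⟨ *-monoˡ-≤ (n !) (≤-trans (length-filter (λ i → primeDivisor? k (suc i)) (upTo k))
                                                               (≤-reflexive (length-upTo k))) ⟩
  k * n !                           ∎)
  where
  open ≤-Reasoning
  k = n / v
  is = primeDivisorIndices k
  k≢0 : NonZero k
  k≢0 = >-nonZero (≤-trans (s≤s z≤n) K≤k)

  regroup : ∀ k s b → k * (s * b) ≡ s * (k * b)
  regroup = solve 3 (λ k s b → k :* (s :* b) := s :* (k :* b)) refl
    where open +-*-Solver

  go : ∀ is → All (λ i → PrimeDivisor k (suc i)) is → periodCountSum v n is * (k * b) ≤ length is * n !
  go []       []                 = z≤n
  go (i ∷ is) ((pr , q∣k) ∷ prs) = begin
    (periodCount v n (n / suc i) + periodCountSum v n is) * (k * b)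
      ≡⟨ *-distribʳ-+ (k * b) (periodCount v n (n / suc i)) (periodCountSum v n is) ⟩
    periodCount v n (n / suc i) * (k * b) + periodCountSum v n is * (k * b)
      ≤⟨ +-mono-≤ (PrimeDivisorCount.bound v n≡kv (suc i) q∣k 2≤v (prime⇒1< pr) {b} K≤k) (go is prs) ⟩
    n ! + length is * n ! ∎

-- Passage from natural to rational inequalities.

toℚᵘ-fromℕ : ∀ m → toℚᵘ (fromℕ m) ℚᵘ.≃ mkℚᵘ (ℤ.+ m) 0
toℚᵘ-fromℕ m = ℚ.toℚᵘ-fromℚᵘ (mkℚᵘ (ℤ.+ m) 0)

fromℕ-+ : ∀ m n → fromℕ (m + n) ≡ fromℕ m ℚ.+ fromℕ n
fromℕ-+ m n = ℚ.toℚᵘ-injective (begin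
  toℚᵘ (fromℕ (m + n))                 ≈⟨ toℚᵘ-fromℕ (m + n) ⟩
  mkℚᵘ (ℤ.+ (m + n)) 0                   ≈⟨ ℚᵘ.*≡* (cong (ℤ._* ℤ.+ 1) (sym (cong₂ ℤ._+_ (ℤ.*-identityʳ (ℤ.+ m)) (ℤ.*-identityʳ (ℤ.+ n))))) ⟩
  mkℚᵘ (ℤ.+ m) 0 ℚᵘ.+ mkℚᵘ (ℤ.+ n) 0       ≈⟨ ℚᵘ.+-cong (toℚᵘ-fromℕ m) (toℚᵘ-fromℕ n) ⟨
  toℚᵘ (fromℕ m) ℚᵘ.+ toℚᵘ (fromℕ n)   ≈⟨ ℚ.toℚᵘ-homo-+ (fromℕ m) (fromℕ n) ⟨
  toℚᵘ (fromℕ m ℚ.+ fromℕ n)           ∎)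
  where open ℚᵘ.≃-Reasoning

fromℕ-mono : ∀ m n → m ≤ n → fromℕ m ℚ.≤ fromℕ n
fromℕ-mono m n m≤n = ℚ.toℚᵘ-cancel-≤ (begin
  toℚᵘ (fromℕ m)  ≃⟨ toℚᵘ-fromℕ m ⟩
  mkℚᵘ (ℤ.+ m) 0    ≤⟨ ℚᵘ.*≤* (ℤ.*-monoʳ-≤-nonNeg (ℤ.+ 1) (ℤ.+≤+ m≤n)) ⟩
  mkℚᵘ (ℤ.+ n) 0    ≃⟨ toℚᵘ-fromℕ n ⟨
  toℚᵘ (fromℕ n)  ∎)
  where open ℚᵘ.≤-Reasoning

fromℕ-*-/ : ∀ x a b y .{{_ : NonZero b}} → x * a ≡ y * b → fromℕ x ℚ.* (ℤ.+ a ℚ./ b) ≡ fromℕ y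
fromℕ-*-/ x a (suc b-1) y xa≡yb = ℚ.toℚᵘ-injective (begin
  toℚᵘ (fromℕ x ℚ.* (ℤ.+ a ℚ./ suc b-1))          ≈⟨ ℚ.toℚᵘ-homo-* (fromℕ x) (ℤ.+ a ℚ./ suc b-1) ⟩
  toℚᵘ (fromℕ x) ℚᵘ.* toℚᵘ (ℤ.+ a ℚ./ suc b-1)    ≈⟨ ℚᵘ.*-cong (toℚᵘ-fromℕ x) (ℚ.toℚᵘ-fromℚᵘ (mkℚᵘ (ℤ.+ a) b-1)) ⟩
  mkℚᵘ (ℤ.+ x) 0 ℚᵘ.* mkℚᵘ (ℤ.+ a) b-1              ≈⟨ ℚᵘ.*≡* cross ⟩
  mkℚᵘ (ℤ.+ y) 0                                  ≈⟨ toℚᵘ-fromℕ y ⟨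
  toℚᵘ (fromℕ y)                                ∎)
  where
  open ℚᵘ.≃-Reasoning
  cross : ℤ.+ x ℤ.* ℤ.+ a ℤ.* ℤ.+ 1 ≡ ℤ.+ y ℤ.* ℤ.+ suc (b-1 + 0)
  cross = trans (ℤ.*-identityʳ _) (trans (sym (ℤ.pos-* x a)) (trans (cong ℤ.+_ xa≡yb)
    (trans (cong (λ b → ℤ.+ (y * suc b)) (sym (+-identityʳ b-1))) (ℤ.pos-* y _))))

-- A positive rational has numerator at least 1, so it is at least the reciprocal of its
-- denominator.
≤-fromℕ-* : ∀ x y ε → 0ℚ ℚ.< ε → x * ↧ₙ ε ≤ y → fromℕ x ℚ.≤ fromℕ y ℚ.* ε
≤-fromℕ-* _ _ (mkℚ (ℤ.+ zero)  _ _) (ℚ.*<* (ℤ.+<+ ())) _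
≤-fromℕ-* _ _ (mkℚ -[1+ _ ]  _ _) (ℚ.*<* ())         _
≤-fromℕ-* x y ε@(mkℚ (ℤ.+ suc a) b-1 _) _ xb≤y = ℚ.toℚᵘ-cancel-≤ (begin
  toℚᵘ (fromℕ x)                          ≃⟨ toℚᵘ-fromℕ x ⟩
  mkℚᵘ (ℤ.+ x) 0                            ≤⟨ ℚᵘ.*≤* cross ⟩
  mkℚᵘ (ℤ.+ y) 0 ℚᵘ.* mkℚᵘ (ℤ.+ suc a) b-1    ≃⟨ ℚᵘ.*-congʳ {toℚᵘ ε} (toℚᵘ-fromℕ y) ⟨
  toℚᵘ (fromℕ y) ℚᵘ.* toℚᵘ ε              ≃⟨ ℚ.toℚᵘ-homo-* (fromℕ y) ε ⟨
  toℚᵘ (fromℕ y ℚ.* ε)                    ∎)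
  where
  open ℚᵘ.≤-Reasoning
  cross : ℤ.+ x ℤ.* ℤ.+ suc (b-1 + 0) ℤ.≤ ℤ.+ y ℤ.* ℤ.+ suc a ℤ.* ℤ.+ 1
  cross = subst₂ ℤ._≤_
    (trans (cong (λ b → ℤ.+ (x * suc b)) (sym (+-identityʳ b-1))) (ℤ.pos-* x _))
    (trans (ℤ.pos-* y (suc a)) (sym (ℤ.*-identityʳ _)))
    (ℤ.+≤+ (≤-trans xb≤y (m≤m*n y (suc a))))

x+y-y≡x : ∀ x y → x ℚ.+ y ℚ.- y ≡ x
x+y-y≡x x y = trans (ℚ.+-assoc x y (ℚ.- y)) (trans (cong (x ℚ.+_) (ℚ.+-inverseʳ y)) (ℚ.+-identityʳ x))

x*[1-y] : ∀ x y → x ℚ.* (1ℚ ℚ.- y) ≡ x ℚ.- x ℚ.* y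
x*[1-y] x y = trans (ℚ.*-distribˡ-+ x 1ℚ (ℚ.- y)) (cong₂ ℚ._+_ (ℚ.*-identityʳ x) (sym (ℚ.neg-distribʳ-* x y)))

-- Serves both lower bounds: `y` is the sum of ratios in the explicit one and `ε` in the asymptotic
-- one.
x*[1-y]≤ : ∀ n t a (y : ℚ) → fromℕ a ℚ.≤ fromℕ n ℚ.* y → n ≤ t + a →
           fromℕ n ℚ.* (1ℚ ℚ.- y) ℚ.≤ fromℕ t
x*[1-y]≤ n t a y a≤ny n≤t+a = begin
  fromℕ n ℚ.* (1ℚ ℚ.- y)         ≡⟨ x*[1-y] (fromℕ n) y ⟩
  fromℕ n ℚ.- fromℕ n ℚ.* y      ≤⟨ ℚ.+-mono-≤ (fromℕ-mono n (t + a) n≤t+a) (ℚ.neg-antimono-≤ a≤ny) ⟩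
  fromℕ (t + a) ℚ.- fromℕ a      ≡⟨ cong (ℚ._- fromℕ a) (fromℕ-+ t a) ⟩
  fromℕ t ℚ.+ fromℕ a ℚ.- fromℕ a ≡⟨ x+y-y≡x (fromℕ t) (fromℕ a) ⟩
  fromℕ t                        ∎
  where open ℚ.≤-Reasoning

≤x*[1-y] : ∀ n t a (y : ℚ) → fromℕ n ℚ.* y ≡ fromℕ a → t + a ≤ n →
           fromℕ t ℚ.≤ fromℕ n ℚ.* (1ℚ ℚ.- y)
≤x*[1-y] n t a y ny≡a t+a≤n = begin
  fromℕ t                          ≡⟨ x+y-y≡x (fromℕ t) (fromℕ a) ⟨
  fromℕ t ℚ.+ fromℕ a ℚ.- fromℕ a  ≡⟨ cong (ℚ._- fromℕ a) (fromℕ-+ t a) ⟨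
  fromℕ (t + a) ℚ.- fromℕ a        ≤⟨ ℚ.+-monoˡ-≤ (ℚ.- fromℕ a) (fromℕ-mono (t + a) n t+a≤n) ⟩
  fromℕ n ℚ.- fromℕ a              ≡⟨ cong (ℚ._-_ (fromℕ n)) ny≡a ⟨
  fromℕ n ℚ.- fromℕ n ℚ.* y        ≡⟨ x*[1-y] (fromℕ n) y ⟨
  fromℕ n ℚ.* (1ℚ ℚ.- y)           ∎
  where open ℚ.≤-Reasoning

-- `PrimeDivisorCount.identity` solved for A_q; the `n !` cancels against the denominator of
-- `ratio`.
!*ratio : ∀ v .{{_ : NonZero v}} {n} .{{_ : NonZero n}} → n ≡ n / v * v →
          ∀ q .{{_ : NonZero q}} → q ∣ n / v →
          fromℕ (n !) ℚ.* ratio v n q ≡ fromℕ (periodCount v n (n / q))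
!*ratio v {n} n≡kv q q∣k = fromℕ-*-/ (n !) _ (n ! * ((n / v / q) !) ^ v) A
  {{m*n≢0 (n !) _ {{n !≢0}} {{m^n≢0 ((n / v / q) !) v {{(n / v / q) !≢0}}}}}} (begin
  n ! * ((n / q) ! * ((n / v) !) ^ v)          ≡⟨ cong (n ! *_) (PrimeDivisorCount.identity v n≡kv q q∣k) ⟨
  n ! * (A * ((n / v / q) !) ^ v)              ≡⟨ regroup (n !) A _ ⟩
  A * (n ! * ((n / v / q) !) ^ v)              ∎)
  where
  open ≡-Reasoning
  A : ℕ
  A = periodCount v n (n / q)
  regroup : ∀ a b c → a * (b * c) ≡ b * (a * c)
  regroup = solve 3 (λ a b c → a :* (b :* c) := b :* (a :* c)) refl
    where open +-*-Solver

!*∑ratio : ∀ v .{{_ : NonZero v}} {n} .{{_ : NonZero n}} → n ≡ n / v * v →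
           fromℕ (n !) ℚ.* ∑primeDivisors (n / v) (λ q → ratio v n q) ≡
           fromℕ (periodCountSum v n (primeDivisorIndices (n / v)))
!*∑ratio v {n} n≡kv = go (primeDivisorIndices (n / v)) (primeDivisorIndices-sound (n / v))
  where
  go : ∀ is → All (λ i → PrimeDivisor (n / v) (suc i)) is →
       fromℕ (n !) ℚ.* foldr ℚ._+_ 0ℚ (map (λ i → ratio v n (suc i)) is) ≡ fromℕ (periodCountSum v n is)
  go []       []                = ℚ.*-zeroʳ (fromℕ (n !))
  go (i ∷ is) ((_ , q∣k) ∷ prs) = trans (ℚ.*-distribˡ-+ (fromℕ (n !)) (ratio v n (suc i)) _)
    (trans (cong₂ ℚ._+_ (!*ratio v n≡kv (suc i) q∣k) (go is prs))
           (sym (fromℕ-+ (periodCount v n (n / suc i)) (periodCountSum v n is))))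

-- Specialisation to n = p - 1.

pred-divides : ∀ v .{{_ : NonZero v}} {p} → p % v ≡ 1 → p ∸ 1 ≡ (p ∸ 1) / v * v
pred-divides v {p} p%v≡1 = sym (m/n*n≡m (divides (p / v)
  (cong (_∸ 1) (trans (m≡m%n+[m/n]*n p v) (cong (_+ p / v * v) p%v≡1)))))

pred-nonZero : ∀ {p} → Prime p → NonZero (p ∸ 1)
pred-nonZero {p} pr = >-nonZero (m<n⇒0<n∸m (prime⇒1< pr))

theorem1 : ∀ (v : ℕ) .{{_ : NonZero v}} → 2 ≤ v →
    (∀ (p : ℕ) → Prime p → p % v ≡ 1 → v < p ∸ 1 →
       let N = p ∸ 1
           k = N / v
           T = fullPeriodCount v N
       in
       fromℕ (N !) ℚ.* (1ℚ ℚ.- ∑primeDivisors k (λ q → ratio v N q)) ℚ.≤ fromℕ T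
       ×
       (∀ (q′ : ℕ) .{{_ : NonZero q′}} → IsLeastPrimeDivisor k q′ →
          fromℕ T ℚ.≤ fromℕ (N !) ℚ.* (1ℚ ℚ.- ratio v N q′)))
    ×
    (∀ (ε : ℚ) → 0ℚ ℚ.< ε →
       ∃ λ (n-ε : ℕ) → ∀ (p : ℕ) → Prime p → n-ε ≤ p → p % v ≡ 1 →
         let N = p ∸ 1
             T = fullPeriodCount v N
         in
         fromℕ (N !) ℚ.* (1ℚ ℚ.- ε) ℚ.≤ fromℕ T
         ×
         fromℕ T ℚ.≤ fromℕ (N !))
theorem1 v 2≤v = (λ p pr p%v≡1 _ → lower p pr p%v≡1 , upper p pr p%v≡1) , asymptotics
  where
  module _ (p : ℕ) (pr : Prime p) (p%v≡1 : p % v ≡ 1) where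
    N = p ∸ 1
    k = N / v
    T = fullPeriodCount v N
    A = periodCountSum v N (primeDivisorIndices k)
    instance
      N≢0 : NonZero N
      N≢0 = pred-nonZero pr
    N≡kv : N ≡ k * v
    N≡kv = pred-divides v p%v≡1

    lower : fromℕ (N !) ℚ.* (1ℚ ℚ.- ∑primeDivisors k (λ q → ratio v N q)) ℚ.≤ fromℕ T
    lower = x*[1-y]≤ (N !) T A (∑primeDivisors k (λ q → ratio v N q))
      (ℚ.≤-reflexive (sym (!*∑ratio v N≡kv))) (fullPeriodCount-lower {v} {k} {N} N≡kv)

    upper : ∀ q′ .{{_ : NonZero q′}} → IsLeastPrimeDivisor k q′ →
            fromℕ T ℚ.≤ fromℕ (N !) ℚ.* (1ℚ ℚ.- ratio v N q′)
    upper q′ ((pr-q , q∣k) , _) = ≤x*[1-y] (N !) T (periodCount v N (N / q′)) (ratio v N q′)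
      (!*ratio v N≡kv q′ q∣k) (fullPeriodCount-upper v N (m/n<m N q′ (prime⇒1< pr-q)))

    estimate : ∀ ε → 0ℚ ℚ.< ε → threshold (↧ₙ ε) ≤ k →
               fromℕ (N !) ℚ.* (1ℚ ℚ.- ε) ℚ.≤ fromℕ T × fromℕ T ℚ.≤ fromℕ (N !)
    estimate ε 0<ε K≤k =
      x*[1-y]≤ (N !) T A ε
        (≤-fromℕ-* A (N !) ε 0<ε (periodCountSum-bound v N≡kv 2≤v (↧ₙ ε) K≤k))
        (fullPeriodCount-lower {v} {k} {N} N≡kv) ,
      fromℕ-mono T (N !) (fullPeriodCount≤! v N)

  asymptotics : ∀ ε → 0ℚ ℚ.< ε →
    ∃ λ n-ε → ∀ p → Prime p → n-ε ≤ p → p % v ≡ 1 →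
      fromℕ ((p ∸ 1) !) ℚ.* (1ℚ ℚ.- ε) ℚ.≤ fromℕ (fullPeriodCount v (p ∸ 1)) ×
      fromℕ (fullPeriodCount v (p ∸ 1)) ℚ.≤ fromℕ ((p ∸ 1) !)
  -- The `suc` makes up for the 1 lost in `p ∸ 1`: from `p ∸ 1 = k * v` at least
  -- `threshold (↧ₙ ε) * v`, cancelling `v` gives the bound on `k` that `estimate` requires.
  asymptotics ε 0<ε = suc (threshold (↧ₙ ε) * v) , λ p pr Kv<p p%v≡1 →
    estimate p pr p%v≡1 ε 0<ε
      (*-cancelʳ-≤ _ _ v (≤-trans (∸-monoˡ-≤ 1 Kv<p) (≤-reflexive (pred-divides v p%v≡1))))
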